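{- For every integer $n\ge 1$ the following identities hold: (i) $\tau(n) = n^2\sigma_7(n) - 540 \sum_{m=1}^{n-1}m(n-m)\sigma_3(m)\sigma_3(n-m)$; (ii) $\tau(n) = -\frac{5}{4} n^2\sigma_7(n) + \frac{9}{4} n^2\sigma_3(n) + 540\sum_{m=1}^{n-1}m^2\sigma_3(m)\sigma_3(n-m)$; (iii) $\tau(n) = n^2\sigma_7(n) - \frac{1080}{n}\sum_{m=1}^{n-1}m^2(n-m)\sigma_3(m)\sigma_3(n-m)$; (iv) $\tau(n) = -\frac{1}{2} n^2\sigma_7(n) + \frac{3}{2} n^2\sigma_3(n) + \frac{360}{n}\sum_{m=1}^{n-1}m^3\sigma_3(m)\sigma_3(n-m)$.
   Context: $\tau(n)$ is Ramanujan's tau function, defined by $q\prod_{n\ge 1}(1-q^n)^{24} = \sum_{n\ge 1}\tau(n)q^n$. For $k\ge 1$, $\sigma_k(n)=\sum_{d\mid n} d^k$ (sum over positive divisors of $n$). For $n=1$ the sum $\sum_{m=1}^{n-1}$ is empty and equals $0$. -}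

module Defs where

open import Data.Fin.Base using (Fin; zero; suc; toℕ)
open import Data.Fin.Properties using (toℕ<n)
open import Data.Integer.Base using (ℤ; +_; 0ℤ; 1ℤ; _+_; _-_; _*_)
import Data.Integer.Properties as ℤ
open import Data.List.Base using (List; applyUpTo; filter; map)
open import Data.Nat.Base using (ℕ; zero; suc; _∸_; _^_; _≤_; _<_; z≤n; s≤s)
open import Data.Nat.Divisibility using (_∣?_)
open import Data.Nat.ListAction using (sum)
open import Data.Nat.Properties using (≤-trans; ≤-<-trans; m∸n≤m; m≤n⇒m<n∨m≡n)
open import Data.Product.Base using (∃-syntax; _,_)
open import Data.Rational.Base using (ℚ; _/_)
open import Data.Sum.Base using (inj₁; inj₂)
open import Relation.Binary.PropositionalEquality using (_≡_; refl; trans; cong; cong₂)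

open import Algebra.Properties.Semiring.Sum ℤ.+-*-semiring
  using (sum⁺-syntax; sum-cong-≗; sum-replicate-zero)

fromℤ : ℤ → ℚ
fromℤ z = z / 1

fromℕ : ℕ → ℚ
fromℕ n = fromℤ (+ n)

[1⋯_] : ℕ → List ℕ
[1⋯ n ] = applyUpTo suc n

∑₁ : ℕ → (ℕ → ℕ) → ℕ
∑₁ n f = sum (map f [1⋯ n ∸ 1 ])

infix 6 ∑₁
syntax ∑₁ n (λ m → x) = ∑[1≤ m < n ] x

σ : ℕ → ℕ → ℕ
σ k n = sum (map (_^ k) (filter (_∣? n) [1⋯ n ]))

-- Formal power series over ℤ, given by their coefficients.
Series : Set
Series = ℕ → ℤ

infixl 7 _⊛_
infixl 6 _⊖_
infixr 8 _^ˢ_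

_⊖_ : Series → Series → Series
(f ⊖ g) n = f n - g n

_⊛_ : Series → Series → Series
(f ⊛ g) n = ∑[ i ≤ n ] (f (toℕ i) * g (n ∸ toℕ i))

𝟙 : Series
𝟙 zero    = 1ℤ
𝟙 (suc _) = 0ℤ

q : Series
q 1 = 1ℤ
q _ = 0ℤ

_^ˢ_ : Series → ℕ → Series
f ^ˢ zero  = 𝟙
f ^ˢ suc n = f ⊛ f ^ˢ n

-- ∏ N F = F 1 ⊛ ⋯ ⊛ F N
∏ : ℕ → (ℕ → Series) → Series
∏ zero    F = 𝟙
∏ (suc N) F = F (suc N) ⊛ ∏ N F

-- The infinite product of the F m, m ≥ 1.  It is only meaningful when
-- F m ≡ 1 modulo q ^ m for every m ≥ 1: the n-th coefficient of ∏ N F is then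
-- the same for all N ≥ n, and ∏∞ F is the limit (see ∏-converges).
∏∞ : (ℕ → Series) → Series
∏∞ F n = ∏ n F n

[1-q^_]²⁴ : ℕ → Series
[1-q^ m ]²⁴ = (𝟙 ⊖ q ^ˢ m) ^ˢ 24

τ : ℕ → ℤ
τ = q ⊛ ∏∞ [1-q^_]²⁴

-- Convergence for the q-adic topology.
_⟶_ : (ℕ → Series) → Series → Set
S ⟶ f = ∀ n → ∃[ N₀ ] (∀ N → N₀ ≤ N → S N n ≡ f n)

_≡_mod-q^_ : Series → Series → ℕ → Set
f ≡ g mod-q^ m = ∀ k → k < m → f k ≡ g k

private
  ∑-zero : ∀ {n} (t : Fin (suc n) → ℤ) → (∀ i → t i ≡ 0ℤ) → ∑[ i ≤ n ] t i ≡ 0ℤ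
  ∑-zero {n} t t≡0 = trans (sum-cong-≗ t≡0) (sum-replicate-zero (suc n))

  ⊛-identityˡ-mod : ∀ {m} g f → g ≡ 𝟙 mod-q^ m → (g ⊛ f) ≡ f mod-q^ m
  ⊛-identityˡ-mod g f g≡𝟙 zero 0<m =
    trans (ℤ.+-identityʳ _) (trans (cong (_* f 0) (g≡𝟙 0 0<m)) (ℤ.*-identityˡ (f 0)))
  ⊛-identityˡ-mod g f g≡𝟙 (suc k) k<m = trans
    (cong₂ _+_
      (trans (cong (_* f (suc k)) (g≡𝟙 0 (≤-trans (s≤s z≤n) k<m))) (ℤ.*-identityˡ _))
      (∑-zero _ λ i → cong (_* f (k ∸ toℕ i))
        (g≡𝟙 (suc (toℕ i)) (≤-<-trans (toℕ<n i) k<m))))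
    (ℤ.+-identityʳ _)

  q^m≡0 : ∀ m k → k < m → (q ^ˢ m) k ≡ 0ℤ
  q^m≡0 (suc m) k (s≤s k≤m) = ∑-zero _ (term k k≤m)
    where
    term : ∀ k → k ≤ m → (i : Fin (suc k)) → q (toℕ i) * (q ^ˢ m) (k ∸ toℕ i) ≡ 0ℤ
    term k       _   zero    = refl
    term (suc k) k<m (suc i) =
      trans (cong (q (suc (toℕ i)) *_) (q^m≡0 m (k ∸ toℕ i) (≤-<-trans (m∸n≤m k (toℕ i)) k<m)))
            (ℤ.*-zeroʳ (q (suc (toℕ i))))

  ^ˢ-mod : ∀ {m} f → f ≡ 𝟙 mod-q^ m → ∀ e → (f ^ˢ e) ≡ 𝟙 mod-q^ m
  ^ˢ-mod f f≡𝟙 zero    k k<m = refl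
  ^ˢ-mod f f≡𝟙 (suc e) k k<m =
    trans (⊛-identityˡ-mod f (f ^ˢ e) f≡𝟙 k k<m) (^ˢ-mod f f≡𝟙 e k k<m)

∏-converges : ∀ F → (∀ m → F m ≡ 𝟙 mod-q^ m) → (λ N → ∏ N F) ⟶ ∏∞ F
∏-converges F F≡𝟙 n = n , stable
  where
  stable : ∀ N → n ≤ N → ∏ N F n ≡ ∏ n F n
  stable N n≤N with m≤n⇒m<n∨m≡n n≤N
  stable N       _ | inj₂ refl      = refl
  stable (suc N) _ | inj₁ (s≤s n≤N) =
    trans (⊛-identityˡ-mod (F (suc N)) (∏ N F) (F≡𝟙 (suc N)) n (s≤s n≤N)) (stable N n≤N)

[1-q^m]²⁴≡𝟙 : ∀ m → [1-q^ m ]²⁴ ≡ 𝟙 mod-q^ m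
[1-q^m]²⁴≡𝟙 m = ^ˢ-mod (𝟙 ⊖ q ^ˢ m)
  (λ k k<m → trans (cong (𝟙 k -_) (q^m≡0 m k k<m)) (ℤ.+-identityʳ (𝟙 k))) 24

{-# OPTIONS --safe #-}
-- Let u a = qᵃ / (1 - qᵃ).  Since u a · u b = u (a + b) (1 + u a + u b), the numbers
-- c a b = [qⁿ] u a · u b satisfy c a b = e (a + b) + c a (a + b) + c (a + b) b, where e d = [qⁿ] u d.
-- Following Skoruppa, summing this recursion against a polynomial g (a, b) invariant under
-- (a, b) ↦ (-b, a + b) evaluates convolution sums of divisor functions.  Four choices of g evaluate
-- P², PQ, Q² and PR for the Eisenstein series P, Q, R of weights 2, 4, 6: these are Ramanujan's
-- differential equations and Q² = 1 + 480 ∑ σ₇(n) qⁿ.  With D = q d/dq it follows that Q³ - R² and the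
-- product defining τ both solve D f = P f, so they are proportional.  The second Rankin–Cohen bracket
-- of Q with itself is a multiple of Q³ - R², which is (i); the other identities follow from (i), the
-- formula for Q² and the Leibniz rule.
module Submission where

-- No analysis and no dimension count for spaces of modular forms is used. For a fixed coefficient
-- qⁿ all sums over a and b are finite, since `u a` starts at qᵃ and can be cut off at a = n. The
-- recursion spreads each term of the sum against g over the two open triangles a < b and a > b of
-- the square; the invariance of g says exactly that both receive the same weight h (x, y) = g (x, y
-- - x). What remains on the right are the terms e d and the diagonal a = b. The diagonal is the
-- source of the derivatives in Ramanujan's equations: D (u a) = a (u a · u a + u a) gives a · c a a
-- = (n - a) · e a. That D f = P f has a one-dimensional solution space is a statement about
-- coefficients: at qᵏ it determines (k - 1) f k from earlier coefficients, so only f 1 is free. All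
-- of this takes place over ℤ. Denominators are cleared beforehand (6, 30, 42 from sums of powers,
-- then 1728 and 34560) and cancelled coefficient by coefficient; rational numbers enter only in the
-- last part.

open import Defs
open import Algebra.Bundles using (CommutativeRing)
import Algebra.Properties.Semiring.Exp as Exp
import Algebra.Properties.Semiring.Sum as Sum
import Algebra.Solver.Ring as RingSolver
open import Algebra.Solver.Ring.AlmostCommutativeRing using (fromCommutativeRing; _-Raw-AlmostCommutative⟶_; Induced-equivalence)
open import Data.Fin.Base using (zero; suc; toℕ)
open import Data.Fin.Patterns using (0F; 1F)
open import Data.Fin.Properties using (toℕ<n)
import Data.Integer.Base as ℤ
import Data.Integer.Properties as ℤ
open import Data.Integer.Solver using () renaming (module +-*-Solver to ℤSolver)
open import Data.Integer.Tactic.RingSolver using (solve-∀)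
open import Data.List.Base as List using (List; []; _∷_; _∷ʳ_; _++_; applyUpTo; filter)
import Data.List.Properties as List
open import Data.Maybe.Base as Maybe using ()
open import Data.Nat.Base as ℕ using (ℕ; zero; suc; _∸_; _≤_; _<_; s≤s; NonZero)
open import Data.Nat.Divisibility using (_∣_; _∣?_; ∣m+n∣m⇒∣n; ∣m∣n⇒∣m+n; ∣-refl; ∣⇒≤)
open import Data.Nat.ListAction using (sum)
open import Data.Nat.ListAction.Properties using (sum-++)
import Data.Nat.Properties as ℕ
open import Data.Product.Base using (_×_; _,_; proj₂)
open import Data.Rational.Base as ℚ using (_/_)
import Data.Rational.Properties as ℚ
open import Data.Rational.Solver using () renaming (module +-*-Solver to ℚSolver)
import Data.Rational.Unnormalised.Base as ℚᵘ
import Data.Rational.Unnormalised.Properties as ℚᵘ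
open import Data.Vec.Base as Vec using (Vec; []; _∷_; lookup)
open import Data.Vec.Properties using (lookup-map)
open import Function.Base using (_∘_; flip)
open import Level using (0ℓ)
open import Relation.Binary.Consequences using (dec⇒weaklyDec)
open import Relation.Binary.Definitions using (WeaklyDecidable)
open import Relation.Binary.PropositionalEquality
  using (_≡_; _≗_; refl; sym; trans; cong; cong₂; subst; module ≡-Reasoning)
import Relation.Binary.Reasoning.Setoid as ≈-Reasoning
open import Relation.Nullary.Decidable using (Dec; yes; no)
open import Relation.Nullary.Negation using (¬_; contradiction)

-- The differential ring of formal power series over ℤ.

module PowerSeries where

  open import Data.Integer.Base using (ℤ; +_; 0ℤ; 1ℤ; _+_; _-_; -_; _*_)
  open Sum ℤ.+-*-semiring using (sum-cong-≗)
  open ≡-Reasoning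

  infixl 6 _⊕_
  infix 8 ⊝_

  _⊕_ : Series → Series → Series
  (f ⊕ g) n = f n + g n

  ⊝_ : Series → Series
  (⊝ f) n = - f n

  -- The embedding through which the ring solver receives its integer coefficients. It agrees with
  -- `𝟙` at 1 only pointwise, hence `𝟙≗const-1`.
  const : ℤ → Series
  const z zero    = z
  const z (suc _) = 0ℤ

  D : Series → Series
  D f n = + n * f n

  ⊛-cong-≤ : ∀ {f f′ g g′} n → (∀ k → k ≤ n → f k ≡ f′ k) → (∀ k → k ≤ n → g k ≡ g′ k) →
             (f ⊛ g) n ≡ (f′ ⊛ g′) n
  ⊛-cong-≤ n f≡f′ g≡g′ = sum-cong-≗ {n = suc n} λ i →
    cong₂ _*_ (f≡f′ (toℕ i) (ℕ.≤-pred (toℕ<n i))) (g≡g′ (n ∸ toℕ i) (ℕ.m∸n≤m n (toℕ i)))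

  ⊛-cong : ∀ {f f′ g g′} → f ≗ f′ → g ≗ g′ → f ⊛ g ≗ f′ ⊛ g′
  ⊛-cong f≗f′ g≗g′ n = ⊛-cong-≤ n (λ k _ → f≗f′ k) (λ k _ → g≗g′ k)

  ⊛-congˡ : ∀ f f′ g → f ≗ f′ → f ⊛ g ≗ f′ ⊛ g
  ⊛-congˡ f f′ g f≗f′ = ⊛-cong {f} {f′} {g} {g} f≗f′ (λ _ → refl)

  ⊛-congʳ : ∀ f g g′ → g ≗ g′ → f ⊛ g ≗ f ⊛ g′
  ⊛-congʳ f g g′ = ⊛-cong {f} {f} {g} {g′} (λ _ → refl)

  -- By computation `(f ⊛ g) (suc n)` is `f 0 * g (suc n) + (f ∘ suc ⊛ g) n`. This and most laws of
  -- `⊛` below are inductions on `n` in which `f` is replaced by its shift.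
  ⊛-distribʳ-⊕ : ∀ h f g → (f ⊕ g) ⊛ h ≗ f ⊛ h ⊕ g ⊛ h
  ⊛-distribʳ-⊕ h f g zero = lemma (f 0) (g 0) (h 0)
    where
    lemma : ∀ x y z → (x + y) * z + 0ℤ ≡ (x * z + 0ℤ) + (y * z + 0ℤ)
    lemma = solve-∀
  ⊛-distribʳ-⊕ h f g (suc n) = begin
    (f 0 + g 0) * h (suc n) + ((f ∘ suc ⊕ g ∘ suc) ⊛ h) n
      ≡⟨ cong (_+_ ((f 0 + g 0) * h (suc n))) (⊛-distribʳ-⊕ h (f ∘ suc) (g ∘ suc) n) ⟩
    (f 0 + g 0) * h (suc n) + ((f ∘ suc ⊛ h) n + (g ∘ suc ⊛ h) n)
      ≡⟨ lemma (f 0) (g 0) (h (suc n)) ((f ∘ suc ⊛ h) n) ((g ∘ suc ⊛ h) n) ⟩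
    (f ⊛ h) (suc n) + (g ⊛ h) (suc n) ∎
    where
    lemma : ∀ x y z s t → (x + y) * z + (s + t) ≡ (x * z + s) + (y * z + t)
    lemma = solve-∀

  ⊛-scaleˡ : ∀ z f g → (λ n → z * f n) ⊛ g ≗ λ n → z * (f ⊛ g) n
  ⊛-scaleˡ z f g zero = lemma z (f 0) (g 0)
    where
    lemma : ∀ z x y → z * x * y + 0ℤ ≡ z * (x * y + 0ℤ)
    lemma = solve-∀
  ⊛-scaleˡ z f g (suc n) = begin
    z * f 0 * g (suc n) + ((λ k → z * f (suc k)) ⊛ g) n
      ≡⟨ cong (_+_ (z * f 0 * g (suc n))) (⊛-scaleˡ z (f ∘ suc) g n) ⟩
    z * f 0 * g (suc n) + z * (f ∘ suc ⊛ g) n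
      ≡⟨ lemma z (f 0) (g (suc n)) ((f ∘ suc ⊛ g) n) ⟩
    z * (f ⊛ g) (suc n) ∎
    where
    lemma : ∀ z x y s → z * x * y + z * s ≡ z * (x * y + s)
    lemma = solve-∀

  0-⊛ : ∀ g → (λ _ → 0ℤ) ⊛ g ≗ λ _ → 0ℤ
  0-⊛ g zero    = refl
  0-⊛ g (suc n) = trans (ℤ.+-identityˡ (((λ _ → 0ℤ) ⊛ g) n)) (0-⊛ g n)

  const-⊛ : ∀ z g → const z ⊛ g ≗ λ n → z * g n
  const-⊛ z g zero    = ℤ.+-identityʳ (z * g 0)
  const-⊛ z g (suc n) = trans
    (cong (_+_ (z * g (suc n))) (0-⊛ g n))
    (ℤ.+-identityʳ (z * g (suc n)))

  -- The defining recursion splits off the first term of the convolution, this one the last;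
  -- commutativity is the match between the two.
  ⊛-unfoldʳ : ∀ f g n → (f ⊛ g) (suc n) ≡ (f ⊛ g ∘ suc) n + f (suc n) * g 0
  ⊛-unfoldʳ f g zero    = lemma (f 0 * g 1) (f 1 * g 0)
    where
    lemma : ∀ x y → x + (y + 0ℤ) ≡ x + 0ℤ + y
    lemma = solve-∀
  ⊛-unfoldʳ f g (suc n) = trans
    (cong (_+_ (f 0 * g (suc (suc n)))) (⊛-unfoldʳ (f ∘ suc) g n))
    (sym (ℤ.+-assoc (f 0 * g (suc (suc n))) ((f ∘ suc ⊛ g ∘ suc) n) (f (suc (suc n)) * g 0)))

  ⊛-comm : ∀ f g → f ⊛ g ≗ g ⊛ f
  ⊛-comm f g zero    = cong (_+ 0ℤ) (ℤ.*-comm (f 0) (g 0))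
  ⊛-comm f g (suc n) = begin
    f 0 * g (suc n) + (f ∘ suc ⊛ g) n ≡⟨ cong₂ _+_ (ℤ.*-comm (f 0) (g (suc n))) (⊛-comm (f ∘ suc) g n) ⟩
    g (suc n) * f 0 + (g ⊛ f ∘ suc) n ≡⟨ ℤ.+-comm (g (suc n) * f 0) ((g ⊛ f ∘ suc) n) ⟩
    (g ⊛ f ∘ suc) n + g (suc n) * f 0 ≡⟨ ⊛-unfoldʳ g f n ⟨
    (g ⊛ f) (suc n)                   ∎

  ⊛-assoc : ∀ f g h → (f ⊛ g) ⊛ h ≗ f ⊛ (g ⊛ h)
  ⊛-assoc f g h zero = lemma (f 0) (g 0) (h 0)
    where
    lemma : ∀ x y z → (x * y + 0ℤ) * z + 0ℤ ≡ x * (y * z + 0ℤ) + 0ℤ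
    lemma = solve-∀
  ⊛-assoc f g h (suc n) = begin
    fg₀ * h (suc n) + (((λ k → f 0 * g (suc k)) ⊕ (f ∘ suc ⊛ g)) ⊛ h) n
      ≡⟨ cong (_+_ (fg₀ * h (suc n))) (⊛-distribʳ-⊕ h (λ k → f 0 * g (suc k)) (f ∘ suc ⊛ g) n) ⟩
    fg₀ * h (suc n) + (((λ k → f 0 * g (suc k)) ⊛ h) n + ((f ∘ suc ⊛ g) ⊛ h) n)
      ≡⟨ cong (_+_ (fg₀ * h (suc n))) (cong₂ _+_ (⊛-scaleˡ (f 0) (g ∘ suc) h n) (⊛-assoc (f ∘ suc) g h n)) ⟩
    fg₀ * h (suc n) + (f 0 * (g ∘ suc ⊛ h) n + (f ∘ suc ⊛ (g ⊛ h)) n)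
      ≡⟨ lemma (f 0) (g 0) (h (suc n)) ((g ∘ suc ⊛ h) n) ((f ∘ suc ⊛ (g ⊛ h)) n) ⟩
    (f ⊛ (g ⊛ h)) (suc n) ∎
    where
    fg₀ = f 0 * g 0 + 0ℤ
    lemma : ∀ x y z s t → (x * y + 0ℤ) * z + (x * s + t) ≡ x * (y * z + s) + t
    lemma = solve-∀

  𝟙≗const-1 : 𝟙 ≗ const 1ℤ
  𝟙≗const-1 zero    = refl
  𝟙≗const-1 (suc _) = refl

  ⊛-identityˡ : ∀ f → 𝟙 ⊛ f ≗ f
  ⊛-identityˡ f n = begin
    (𝟙 ⊛ f) n        ≡⟨ ⊛-congˡ 𝟙 (const 1ℤ) f 𝟙≗const-1 n ⟩
    (const 1ℤ ⊛ f) n ≡⟨ const-⊛ 1ℤ f n ⟩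
    1ℤ * f n         ≡⟨ ℤ.*-identityˡ (f n) ⟩
    f n              ∎

  D-⊛ : ∀ f g → D (f ⊛ g) ≗ D f ⊛ g ⊕ f ⊛ D g
  D-⊛ f g zero = lemma (f 0) (g 0)
    where
    lemma : ∀ x y → 0ℤ * (x * y + 0ℤ) ≡ (0ℤ * x * y + 0ℤ) + (x * (0ℤ * y) + 0ℤ)
    lemma = solve-∀
  D-⊛ f g (suc n) = begin
    (1ℤ + + n) * (f 0 * g (suc n) + s)
      ≡⟨ lemma (+ n) (f 0) (g (suc n)) s ⟩
    (1ℤ + + n) * (f 0 * g (suc n)) + (+ n * s + s)
      ≡⟨ cong (λ t → (1ℤ + + n) * (f 0 * g (suc n)) + (t + s)) (D-⊛ (f ∘ suc) g n) ⟩
    (1ℤ + + n) * (f 0 * g (suc n)) + ((D (f ∘ suc) ⊛ g) n + (f ∘ suc ⊛ D g) n + s)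
      ≡⟨ lemma₂ (+ n) (f 0) (g (suc n)) ((D (f ∘ suc) ⊛ g) n) ((f ∘ suc ⊛ D g) n) s ⟩
    (0ℤ * f 0 * g (suc n) + ((D (f ∘ suc) ⊛ g) n + s)) + (f ⊛ D g) (suc n)
      ≡⟨ cong (λ t → (0ℤ * f 0 * g (suc n) + t) + (f ⊛ D g) (suc n)) D-shift ⟨
    (D f ⊛ g) (suc n) + (f ⊛ D g) (suc n) ∎
    where
    s = (f ∘ suc ⊛ g) n
    lemma : ∀ n x y s → (1ℤ + n) * (x * y + s) ≡ (1ℤ + n) * (x * y) + (n * s + s)
    lemma = solve-∀
    lemma₂ : ∀ n x y r t s → (1ℤ + n) * (x * y) + (r + t + s) ≡
             (0ℤ * x * y + (r + s)) + (x * ((1ℤ + n) * y) + t)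
    lemma₂ = solve-∀
    lemma₃ : ∀ k x → (1ℤ + k) * x ≡ k * x + x
    lemma₃ = solve-∀
    -- Shifting `D f` leaves the weight k + 1 on the k-th coefficient where `D (f ∘ suc)` has k; the
    -- surplus is `s`.
    D-shift : (D f ∘ suc ⊛ g) n ≡ (D (f ∘ suc) ⊛ g) n + s
    D-shift = trans
      (⊛-congˡ (D f ∘ suc) (D (f ∘ suc) ⊕ f ∘ suc) g (λ k → lemma₃ (+ k) (f (suc k))) n)
      (⊛-distribʳ-⊕ g (D (f ∘ suc)) (f ∘ suc) n)

  Series-commutativeRing : CommutativeRing 0ℓ 0ℓ
  Series-commutativeRing = record
    { Carrier = Series
    ; _≈_ = _≗_
    ; _+_ = _⊕_
    ; _*_ = _⊛_
    ; -_ = ⊝_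
    ; 0# = const 0ℤ
    ; 1# = 𝟙
    ; isCommutativeRing = record
      { isRing = record
        { +-isAbelianGroup = record
          { isGroup = record
            { isMonoid = record
              { isSemigroup = record
                { isMagma = record
                  { isEquivalence = record
                    { refl = λ _ → refl
                    ; sym = λ p n → sym (p n)
                    ; trans = λ p q n → trans (p n) (q n)
                    }
                  ; ∙-cong = λ p q n → cong₂ _+_ (p n) (q n)
                  }
                ; assoc = λ f g h n → ℤ.+-assoc (f n) (g n) (h n)
                }
              -- `const 0ℤ n` reduces only when `n` is a constructor, hence the case splits.
              ; identity =
                  (λ { f zero → ℤ.+-identityˡ (f 0) ; f (suc n) → ℤ.+-identityˡ (f (suc n)) }) ,
                  (λ { f zero → ℤ.+-identityʳ (f 0) ; f (suc n) → ℤ.+-identityʳ (f (suc n)) })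
              }
            ; inverse =
                (λ { f zero → ℤ.+-inverseˡ (f 0) ; f (suc n) → ℤ.+-inverseˡ (f (suc n)) }) ,
                (λ { f zero → ℤ.+-inverseʳ (f 0) ; f (suc n) → ℤ.+-inverseʳ (f (suc n)) })
            ; ⁻¹-cong = λ p n → cong -_ (p n)
            }
          ; comm = λ f g n → ℤ.+-comm (f n) (g n)
          }
        ; *-cong = λ {f} {f′} {g} {g′} → ⊛-cong {f} {f′} {g} {g′}
        ; *-assoc = ⊛-assoc
        ; *-identity = ⊛-identityˡ , λ f n → trans (⊛-comm f 𝟙 n) (⊛-identityˡ f n)
        ; distrib =
            (λ f g h n → trans (⊛-comm f (g ⊕ h) n) (trans (⊛-distribʳ-⊕ f g h n)
              (cong₂ _+_ (⊛-comm g f n) (⊛-comm h f n)))) ,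
            ⊛-distribʳ-⊕
        }
      ; *-comm = ⊛-comm
      }
    }

  -- Equality of series is not decidable, so the solver is to compare coefficients in ℤ and
  -- transport them by `const`.
  const-homomorphism : CommutativeRing.rawRing ℤ.+-*-commutativeRing
                       -Raw-AlmostCommutative⟶ fromCommutativeRing Series-commutativeRing
  const-homomorphism = record
    { ⟦_⟧    = const
    ; +-homo = λ { x y zero → refl ; x y (suc n) → refl }
    ; *-homo = λ { x y zero → sym (const-⊛ x (const y) 0)
                 ; x y (suc n) → sym (trans (const-⊛ x (const y) (suc n)) (ℤ.*-zeroʳ x)) }
    ; -‿homo = λ { x zero → refl ; x (suc n) → refl }
    ; 0-homo = λ _ → refl
    ; 1-homo = λ { zero → refl ; (suc n) → refl }
    }

-- Double sums, Skoruppa's summation and closed forms for moments.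

module Summation where

  open import Data.Integer.Base using (ℤ; +_; 0ℤ; 1ℤ; _+_; _-_; -_; _*_)
  open Exp ℤ.+-*-semiring using (_^_)
  open ℤSolver
    using (Polynomial; op; con; var; [+]; [*]; _:+_; _:*_; _:-_; _:^_; :-_; ⟦_⟧; normalise; ⟦_⟧N; prove)
  open ≡-Reasoning

  sumTo : ℕ → (ℕ → ℤ) → ℤ
  sumTo zero    f = 0ℤ
  sumTo (suc N) f = sumTo N f + f (suc N)

  sumTo-cong : ∀ N {f g : ℕ → ℤ} → (∀ k → f (suc k) ≡ g (suc k)) → sumTo N f ≡ sumTo N g
  sumTo-cong zero    f≡g = refl
  sumTo-cong (suc N) f≡g = cong₂ _+_ (sumTo-cong N f≡g) (f≡g N)

  sumTo-+ : ∀ N f g → sumTo N (λ k → f k + g k) ≡ sumTo N f + sumTo N g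
  sumTo-+ zero    f g = refl
  sumTo-+ (suc N) f g = trans (cong (_+ (f (suc N) + g (suc N))) (sumTo-+ N f g))
    (interchange (sumTo N f) (sumTo N g) (f (suc N)) (g (suc N)))
    where
    interchange : ∀ x y z w → (x + y) + (z + w) ≡ (x + z) + (y + w)
    interchange = solve-∀

  sumTo-neg : ∀ N f → sumTo N (λ k → - f k) ≡ - sumTo N f
  sumTo-neg zero    f = refl
  sumTo-neg (suc N) f = trans (cong (_+ - f (suc N)) (sumTo-neg N f))
    (sym (ℤ.neg-distrib-+ (sumTo N f) (f (suc N))))

  sumTo-minus : ∀ N f g → sumTo N (λ k → f k - g k) ≡ sumTo N f - sumTo N g
  sumTo-minus N f g = trans (sumTo-+ N f (λ k → - g k)) (cong (_+_ (sumTo N f)) (sumTo-neg N g))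

  sumTo-*ˡ : ∀ N z f → sumTo N (λ k → z * f k) ≡ z * sumTo N f
  sumTo-*ˡ zero    z f = sym (ℤ.*-zeroʳ z)
  sumTo-*ˡ (suc N) z f = trans (cong (_+ z * f (suc N)) (sumTo-*ˡ N z f))
    (sym (ℤ.*-distribˡ-+ z (sumTo N f) (f (suc N))))

  sumTo-0 : ∀ N → sumTo N (λ _ → 0ℤ) ≡ 0ℤ
  sumTo-0 zero    = refl
  sumTo-0 (suc N) = trans (ℤ.+-identityʳ (sumTo N (λ _ → 0ℤ))) (sumTo-0 N)

  sumTo-swap : ∀ M N (F : ℕ → ℕ → ℤ) →
               sumTo M (λ a → sumTo N (F a)) ≡ sumTo N (λ b → sumTo M (λ a → F a b))
  sumTo-swap zero    N F = sym (sumTo-0 N)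
  sumTo-swap (suc M) N F = trans (cong (_+ sumTo N (F (suc M))) (sumTo-swap M N F))
    (sym (sumTo-+ N (λ b → sumTo M (λ a → F a b)) (F (suc M))))

  sumTo-split : ∀ M N f → sumTo (M ℕ.+ N) f ≡ sumTo M f + sumTo N (λ k → f (M ℕ.+ k))
  sumTo-split M zero    f = trans (cong (λ m → sumTo m f) (ℕ.+-identityʳ M)) (sym (ℤ.+-identityʳ (sumTo M f)))
  sumTo-split M (suc N) f = begin
    sumTo (M ℕ.+ suc N) f                       ≡⟨ cong (λ m → sumTo m f) (ℕ.+-suc M N) ⟩
    sumTo (M ℕ.+ N) f + f (suc (M ℕ.+ N))       ≡⟨ cong₂ _+_ (sumTo-split M N f) (cong f (sym (ℕ.+-suc M N))) ⟩
    sumTo M f + sumTo N (λ k → f (M ℕ.+ k)) + f (M ℕ.+ suc N)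
      ≡⟨ ℤ.+-assoc (sumTo M f) (sumTo N (λ k → f (M ℕ.+ k))) (f (M ℕ.+ suc N)) ⟩
    sumTo M f + sumTo (suc N) (λ k → f (M ℕ.+ k)) ∎

  sumTo-truncate : ∀ N M f → (∀ k → N < k → f k ≡ 0ℤ) → sumTo (M ℕ.+ N) f ≡ sumTo N f
  sumTo-truncate N zero    f f≡0 = refl
  sumTo-truncate N (suc M) f f≡0 = trans
    (cong (_+_ (sumTo (M ℕ.+ N) f)) (f≡0 (suc M ℕ.+ N) (s≤s (ℕ.m≤n+m N M))))
    (trans (ℤ.+-identityʳ (sumTo (M ℕ.+ N) f)) (sumTo-truncate N M f f≡0))

  sumTo² : ℕ → (ℕ → ℕ → ℤ) → ℤ
  sumTo² N F = sumTo N (λ a → sumTo N (F a))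

  sumTo< : ℕ → (ℕ → ℕ → ℤ) → ℤ
  sumTo< N F = sumTo N (λ b → sumTo (b ∸ 1) (λ a → F a b))

  sumTo²-trichotomy : ∀ N F → sumTo² N F ≡ sumTo< N F + sumTo< N (flip F) + sumTo N (λ a → F a a)
  sumTo²-trichotomy zero    F = refl
  sumTo²-trichotomy (suc N) F = begin
    sumTo N (λ a → sumTo N (F a) + F a (suc N)) + (row + corner)
      ≡⟨ cong (_+ (row + corner)) (sumTo-+ N (λ a → sumTo N (F a)) (λ a → F a (suc N))) ⟩
    sumTo² N F + col + (row + corner)
      ≡⟨ cong (λ t → t + col + (row + corner)) (sumTo²-trichotomy N F) ⟩
    sumTo< N F + sumTo< N (flip F) + sumTo N (λ a → F a a) + col + (row + corner)
      ≡⟨ lemma (sumTo< N F) (sumTo< N (flip F)) (sumTo N (λ a → F a a)) col row corner ⟩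
    (sumTo< N F + col) + (sumTo< N (flip F) + row) + (sumTo N (λ a → F a a) + corner) ∎
    where
    row = sumTo N (F (suc N))
    col = sumTo N (λ a → F a (suc N))
    corner = F (suc N) (suc N)
    lemma : ∀ x y z c r k → x + y + z + c + (r + k) ≡ (x + c) + (y + r) + (z + k)
    lemma = solve-∀

  -- For fixed `a` the shift b ↦ a + b moves the row onto b > a, and what it pushes beyond `N`
  -- vanishes by hypothesis. The sheared square is therefore exactly the triangle a < b.
  sumTo²-shear : ∀ N F → (∀ a b → N < b → F a b ≡ 0ℤ) →
                 sumTo² N (λ a b → F a (a ℕ.+ b)) ≡ sumTo< N F
  sumTo²-shear N F F≡0 = trans (sumTo-cong N (λ a → row (suc a))) (triangle N)
    where
    lemma : ∀ x y → y ≡ (x + y) - x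
    lemma = solve-∀
    row : ∀ a → sumTo N (λ b → F a (a ℕ.+ b)) ≡ sumTo N (F a) - sumTo a (F a)
    row a = begin
      sumTo N (λ b → F a (a ℕ.+ b))
        ≡⟨ lemma (sumTo a (F a)) (sumTo N (λ b → F a (a ℕ.+ b))) ⟩
      sumTo a (F a) + sumTo N (λ b → F a (a ℕ.+ b)) - sumTo a (F a)
        ≡⟨ cong (_- sumTo a (F a)) (sumTo-split a N (F a)) ⟨
      sumTo (a ℕ.+ N) (F a) - sumTo a (F a)
        ≡⟨ cong (_- sumTo a (F a)) (sumTo-truncate N a (F a) (F≡0 a)) ⟩
      sumTo N (F a) - sumTo a (F a) ∎
    lemma₂ : ∀ x y z → x + y + (z - z) ≡ x + y
    lemma₂ = solve-∀
    lemma₃ : ∀ x y z → x + y - z ≡ (x - z) + y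
    lemma₃ = solve-∀
    triangle : ∀ M → sumTo M (λ a → sumTo M (F a) - sumTo a (F a)) ≡ sumTo< M F
    triangle zero    = refl
    triangle (suc M) = begin
      sumTo M (λ a → sumTo M (F a) + F a (suc M) - sumTo a (F a)) + (z - z)
        ≡⟨ cong (_+ (z - z)) (sumTo-cong M (λ a → lemma₃ (sumTo M (F (suc a))) (F (suc a) (suc M)) (sumTo (suc a) (F (suc a))))) ⟩
      sumTo M (λ a → (sumTo M (F a) - sumTo a (F a)) + F a (suc M)) + (z - z)
        ≡⟨ cong (_+ (z - z)) (sumTo-+ M (λ a → sumTo M (F a) - sumTo a (F a)) (λ a → F a (suc M))) ⟩
      sumTo M (λ a → sumTo M (F a) - sumTo a (F a)) + col + (z - z)
        ≡⟨ lemma₂ (sumTo M (λ a → sumTo M (F a) - sumTo a (F a))) col z ⟩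
      sumTo M (λ a → sumTo M (F a) - sumTo a (F a)) + col
        ≡⟨ cong (_+ col) (triangle M) ⟩
      sumTo< M F + col ∎
      where
      z = sumTo (suc M) (F (suc M))
      col = sumTo M (λ a → F a (suc M))

  sumTo²-cong : ∀ N {F G : ℕ → ℕ → ℤ} → (∀ a b → F (suc a) (suc b) ≡ G (suc a) (suc b)) →
                sumTo² N F ≡ sumTo² N G
  sumTo²-cong N F≡G = sumTo-cong N (λ a → sumTo-cong N (F≡G a))

  sumTo²-+ : ∀ N F G → sumTo² N (λ a b → F a b + G a b) ≡ sumTo² N F + sumTo² N G
  sumTo²-+ N F G = trans (sumTo-cong N (λ a → sumTo-+ N (F (suc a)) (G (suc a))))
    (sumTo-+ N (λ a → sumTo N (F a)) (λ a → sumTo N (G a)))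

  sumTo²-minus : ∀ N F G → sumTo² N (λ a b → F a b - G a b) ≡ sumTo² N F - sumTo² N G
  sumTo²-minus N F G = trans (sumTo-cong N (λ a → sumTo-minus N (F (suc a)) (G (suc a))))
    (sumTo-minus N (λ a → sumTo N (F a)) (λ a → sumTo N (G a)))

  sumTo²-*ˡ : ∀ N z F → sumTo² N (λ a b → z * F a b) ≡ z * sumTo² N F
  sumTo²-*ˡ N z F = trans (sumTo-cong N (λ a → sumTo-*ˡ N z (F (suc a))))
    (sumTo-*ˡ N z (λ a → sumTo N (F a)))

  -- After splitting each c a b in the sum against g by the recursion, the terms c a (a + b) and
  -- c (a + b) b fill the two off-diagonal triangles of the sum against h.
  skoruppa :
    ∀ N (c : ℕ → ℕ → ℤ) (e : ℕ → ℤ) →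
    (∀ a b → c (suc a) (suc b) ≡ e (suc a ℕ.+ suc b) + c (suc a) (suc a ℕ.+ suc b) + c (suc a ℕ.+ suc b) (suc b)) →
    (∀ a b → N < b → c a b ≡ 0ℤ) → (∀ a b → N < a → c a b ≡ 0ℤ) → (∀ d → N < d → e d ≡ 0ℤ) →
    ∀ (g h : ℤ → ℤ → ℤ) → (∀ x y → g x y ≡ h x (x + y)) → (∀ x y → g x y ≡ h (x + y) y) →
    sumTo² N (λ a b → (g (+ a) (+ b) - h (+ a) (+ b)) * c a b) ≡
    sumTo N (λ d → sumTo (d ∸ 1) (λ a → g (+ a) (+ d - + a)) * e d) - sumTo N (λ a → h (+ a) (+ a) * c a a)
  skoruppa N c e c-rec c≡0ʳ c≡0ˡ e≡0 g h g≡hʳ g≡hˡ = begin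
    sumTo² N (λ a b → (g (+ a) (+ b) - h (+ a) (+ b)) * c a b)
      ≡⟨ sumTo²-cong N (λ a b → *-distribʳ-minus (g (+ suc a) (+ suc b)) (h (+ suc a) (+ suc b)) (c (suc a) (suc b))) ⟩
    sumTo² N (λ a b → gc a b - hc a b)
      ≡⟨ sumTo²-minus N gc hc ⟩
    sumTo² N gc - sumTo² N hc
      ≡⟨ cong₂ _-_ gc-split (sumTo²-trichotomy N hc) ⟩
    (sumTo< N ge + sumTo< N hc + sumTo< N (flip hc)) - (sumTo< N hc + sumTo< N (flip hc) + diag)
      ≡⟨ lemma₂ (sumTo< N ge) (sumTo< N hc) (sumTo< N (flip hc)) diag ⟩
    sumTo< N ge - diag
      ≡⟨ cong (_- diag) (sumTo-cong N λ d → trans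
           (sumTo-cong d (λ a → ℤ.*-comm (g (+ suc a) (+ suc d - + suc a)) (e (suc d))))
           (trans (sumTo-*ˡ d (e (suc d)) (λ a → g (+ a) (+ suc d - + a)))
             (ℤ.*-comm (e (suc d)) (sumTo d (λ a → g (+ a) (+ suc d - + a)))))) ⟩
    sumTo N (λ d → sumTo (d ∸ 1) (λ a → g (+ a) (+ d - + a)) * e d) - diag ∎
    where
    gc hc ge : ℕ → ℕ → ℤ
    gc a b = g (+ a) (+ b) * c a b
    hc a b = h (+ a) (+ b) * c a b
    ge a d = g (+ a) (+ d - + a) * e d
    diag = sumTo N (λ a → hc a a)
    *-distribʳ-minus : ∀ x y z → (x - y) * z ≡ x * z - y * z
    *-distribʳ-minus = solve-∀
    lemma₂ : ∀ x y z w → (x + y + z) - (y + z + w) ≡ x - w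
    lemma₂ = solve-∀
    distrib₃ : ∀ x p q r → x * (p + q + r) ≡ x * p + x * q + x * r
    distrib₃ = solve-∀
    b≡a+b-a : ∀ a b → b ≡ a + b - a
    b≡a+b-a = solve-∀
    *-vanish : ∀ x {y} → y ≡ 0ℤ → x * y ≡ 0ℤ
    *-vanish x refl = ℤ.*-zeroʳ x
    gc-rec : ∀ a b → gc (suc a) (suc b) ≡
             ge (suc a) (suc a ℕ.+ suc b) + hc (suc a) (suc a ℕ.+ suc b) + hc (suc a ℕ.+ suc b) (suc b)
    gc-rec a b = begin
      G * c (suc a) (suc b)
        ≡⟨ cong (G *_) (c-rec a b) ⟩
      G * (e s + c (suc a) s + c s (suc b))
        ≡⟨ distrib₃ G (e s) (c (suc a) s) (c s (suc b)) ⟩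
      G * e s + G * c (suc a) s + G * c s (suc b)
        ≡⟨ cong₂ _+_ (cong₂ _+_
             (cong (λ y → g (+ suc a) y * e s) (b≡a+b-a (+ suc a) (+ suc b)))
             (cong (_* c (suc a) s) (g≡hʳ (+ suc a) (+ suc b))))
             (cong (_* c s (suc b)) (g≡hˡ (+ suc a) (+ suc b))) ⟩
      ge (suc a) s + hc (suc a) s + hc s (suc b) ∎
      where
      G = g (+ suc a) (+ suc b)
      s = suc a ℕ.+ suc b
    gc-split : sumTo² N gc ≡ sumTo< N ge + sumTo< N hc + sumTo< N (flip hc)
    gc-split = begin
      sumTo² N gc
        ≡⟨ sumTo²-cong N gc-rec ⟩
      sumTo² N (λ a b → ge a (a ℕ.+ b) + hc a (a ℕ.+ b) + hc (a ℕ.+ b) b)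
        ≡⟨ sumTo²-+ N (λ a b → ge a (a ℕ.+ b) + hc a (a ℕ.+ b)) (λ a b → hc (a ℕ.+ b) b) ⟩
      sumTo² N (λ a b → ge a (a ℕ.+ b) + hc a (a ℕ.+ b)) + sumTo² N (λ a b → hc (a ℕ.+ b) b)
        ≡⟨ cong₂ _+_ (sumTo²-+ N (λ a b → ge a (a ℕ.+ b)) (λ a b → hc a (a ℕ.+ b)))
             -- In the third sum the first argument is the sheared one; exchanging the order of
             -- summation brings it into the form of `sumTo²-shear` for the flipped summand.
             (trans (sumTo-swap N N (λ a b → hc (a ℕ.+ b) b))
               (sumTo²-cong N (λ b a → cong (λ s → hc s (suc b)) (ℕ.+-comm (suc a) (suc b))))) ⟩
      sumTo² N (λ a b → ge a (a ℕ.+ b)) + sumTo² N (λ a b → hc a (a ℕ.+ b)) + sumTo² N (λ b a → hc (b ℕ.+ a) b)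
        ≡⟨ cong₂ _+_ (cong₂ _+_
             (sumTo²-shear N ge (λ a b N<b → *-vanish (g (+ a) (+ b - + a)) (e≡0 b N<b)))
             (sumTo²-shear N hc (λ a b N<b → *-vanish (h (+ a) (+ b)) (c≡0ʳ a b N<b))))
             (sumTo²-shear N (flip hc) (λ a b N<b → *-vanish (h (+ b) (+ a)) (c≡0ˡ b a N<b))) ⟩
      sumTo< N ge + sumTo< N hc + sumTo< N (flip hc) ∎

  -- Telescoping: `F` is a discrete antiderivative of `f`. It is a function on ℤ so that it can
  -- later be a polynomial.
  sumTo-unique : ∀ (f : ℕ → ℤ) (F : ℤ → ℤ) → F 0ℤ ≡ 0ℤ → (∀ m → F (+ m) + f (suc m) ≡ F (1ℤ + + m)) →
                 ∀ m → sumTo m f ≡ F (+ m)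
  sumTo-unique f F F0 step zero    = sym F0
  sumTo-unique f F F0 step (suc m) = trans (cong (_+ f (suc m)) (sumTo-unique f F F0 step m)) (step m)

  infix 4 _≋_
  -- Equal normal forms settle a polynomial identity for all arguments at once, so it can be passed
  -- to `moments` as a hypothesis and discharged by evaluation. As parameters of a record, `p` and
  -- `r` can be inferred, which `normalise p ≡ normalise r` would not allow.
  record _≋_ {k} (p r : Polynomial k) : Set where
    constructor normal
    field
      normalise≡ : normalise p ≡ normalise r

  ≋⇒≡ : ∀ {k} {p r : Polynomial k} → p ≋ r → ∀ ρ → ⟦ p ⟧ ρ ≡ ⟦ r ⟧ ρ
  ≋⇒≡ {p = p} {r} (normal p≡r) ρ = prove ρ p r (cong (λ nf → ⟦ nf ⟧N ρ) p≡r)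

  infix 9 _⟪_⟫
  _⟪_⟫ : ∀ {k l} → Polynomial k → Vec (Polynomial l) k → Polynomial l
  op o p r ⟪ σ ⟫ = op o (p ⟪ σ ⟫) (r ⟪ σ ⟫)
  con z    ⟪ σ ⟫ = con z
  var i    ⟪ σ ⟫ = lookup σ i
  (p :^ m) ⟪ σ ⟫ = (p ⟪ σ ⟫) :^ m
  (:- p)   ⟪ σ ⟫ = :- (p ⟪ σ ⟫)

  ⟦⟧-⟪⟫ : ∀ {k l} (p : Polynomial k) (σ : Vec (Polynomial l) k) ρ →
         ⟦ p ⟪ σ ⟫ ⟧ ρ ≡ ⟦ p ⟧ (Vec.map (λ r → ⟦ r ⟧ ρ) σ)
  ⟦⟧-⟪⟫ (op [+] p r) σ ρ = cong₂ _+_ (⟦⟧-⟪⟫ p σ ρ) (⟦⟧-⟪⟫ r σ ρ)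
  ⟦⟧-⟪⟫ (op [*] p r) σ ρ = cong₂ _*_ (⟦⟧-⟪⟫ p σ ρ) (⟦⟧-⟪⟫ r σ ρ)
  ⟦⟧-⟪⟫ (con z)      σ ρ = refl
  ⟦⟧-⟪⟫ (var i)      σ ρ = sym (lookup-map i (λ r → ⟦ r ⟧ ρ) σ)
  ⟦⟧-⟪⟫ (p :^ m)     σ ρ = cong (_^ m) (⟦⟧-⟪⟫ p σ ρ)
  ⟦⟧-⟪⟫ (:- p)       σ ρ = cong -_ (⟦⟧-⟪⟫ p σ ρ)

  -- An entry `(x , y , k)` stands for (x + y n) dᵏ. The coefficients are affine in `n` because `n`
  -- enters only through the factor n - a of the diagonal.
  combination : ℤ → List (ℤ × ℤ × ℕ) → (ℕ → ℤ) → ℤ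
  combination n []                 f = 0ℤ
  combination n ((x , y , k) ∷ zs) f = (x + y * n) * f k + combination n zs f

  combinationₚ : ∀ {l} → Polynomial l → List (ℤ × ℤ × ℕ) → Polynomial l → Polynomial l
  combinationₚ n []                 d = con 0ℤ
  combinationₚ n ((x , y , k) ∷ zs) d = (con x :+ con y :* n) :* d :^ k :+ combinationₚ n zs d

  ⟦combinationₚ⟧ : ∀ {l} n zs d (ρ : Vec ℤ l) →
    ⟦ combinationₚ n zs d ⟧ ρ ≡ combination (⟦ n ⟧ ρ) zs (⟦ d ⟧ ρ ^_)
  ⟦combinationₚ⟧ n []                 d ρ = refl
  ⟦combinationₚ⟧ n ((x , y , k) ∷ zs) d ρ =
    cong (_+_ ((x + y * ⟦ n ⟧ ρ) * ⟦ d ⟧ ρ ^ k)) (⟦combinationₚ⟧ n zs d ρ)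

  sumTo-combination : ∀ N n zs (f : ℕ → ℕ → ℤ) (e : ℕ → ℤ) →
    sumTo N (λ d → combination n zs (f d) * e d) ≡ combination n zs (λ k → sumTo N (λ d → f d k * e d))
  sumTo-combination N n []                 f e = trans (sumTo-cong N (λ d → ℤ.*-zeroˡ (e (suc d)))) (sumTo-0 N)
  sumTo-combination N n ((x , y , k) ∷ zs) f e = begin
    sumTo N (λ d → (z * f d k + combination n zs (f d)) * e d)
      ≡⟨ sumTo-cong N (λ d → lemma z (f (suc d) k) (combination n zs (f (suc d))) (e (suc d))) ⟩
    sumTo N (λ d → z * (f d k * e d) + combination n zs (f d) * e d)
      ≡⟨ sumTo-+ N (λ d → z * (f d k * e d)) (λ d → combination n zs (f d) * e d) ⟩
    sumTo N (λ d → z * (f d k * e d)) + sumTo N (λ d → combination n zs (f d) * e d)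
      ≡⟨ cong₂ _+_ (sumTo-*ˡ N z (λ d → f d k * e d)) (sumTo-combination N n zs f e) ⟩
    combination n ((x , y , k) ∷ zs) (λ k → sumTo N (λ d → f d k * e d)) ∎
    where
    z = x + y * n
    lemma : ∀ z x y e → (z * x + y) * e ≡ z * (x * e) + y * e
    lemma = solve-∀

  eval₂ : Polynomial 2 → ℤ → ℤ → ℤ
  eval₂ p x y = ⟦ p ⟧ (x ∷ y ∷ [])

  sumTo-polynomial : (g F : Polynomial 2) →
    F ⟪ con 0ℤ ∷ var 1F ∷ [] ⟫ ≋ con 0ℤ →
    F :+ g ⟪ con 1ℤ :+ var 0F ∷ var 1F :- (con 1ℤ :+ var 0F) ∷ [] ⟫ ≋ F ⟪ con 1ℤ :+ var 0F ∷ var 1F ∷ [] ⟫ →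
    ∀ D m → sumTo m (λ a → eval₂ g (+ a) (D - + a)) ≡ eval₂ F (+ m) D
  sumTo-polynomial g F F0≋0 F+g≋F D m = sumTo-unique
    (λ a → eval₂ g (+ a) (D - + a)) (λ m → eval₂ F m D)
    (trans (sym (⟦⟧-⟪⟫ F (con 0ℤ ∷ var 1F ∷ []) (0ℤ ∷ D ∷ []))) (≋⇒≡ F0≋0 (0ℤ ∷ D ∷ [])))
    (λ m → trans
      (cong (_+_ (eval₂ F (+ m) D)) (sym (⟦⟧-⟪⟫ g (con 1ℤ :+ var 0F ∷ var 1F :- (con 1ℤ :+ var 0F) ∷ []) (+ m ∷ D ∷ []))))
      (trans (≋⇒≡ F+g≋F (+ m ∷ D ∷ []))
        (⟦⟧-⟪⟫ F (con 1ℤ :+ var 0F ∷ var 1F ∷ []) (+ m ∷ D ∷ []))))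
    m

  -- N and K are invariant under (x, y) ↦ (-y, x + y); Φ and Ψ are N and K after y ↦ y - x.
  module _ {l} (x y : Polynomial l) where
    N K Φ Ψ : Polynomial l
    N = x :^ 2 :+ x :* y :+ y :^ 2
    K = (x :* y :* (x :+ y)) :^ 2
    Φ = x :^ 2 :- x :* y :+ y :^ 2
    Ψ = (x :* y :* (y :- x)) :^ 2

  -- To be read with `c a b` and `e d` the n-th coefficients of `u a ⊛ u b` and `u d`, and cut-off
  -- `M` equal to n. Then `moment k` and `moment² i j` are the n-th coefficients of `E k` and
  -- `E i ⊛ E j`.
  module Moments
    (M : ℕ) (n : ℤ) (c : ℕ → ℕ → ℤ) (e : ℕ → ℤ)
    (c-rec : ∀ a b → c (suc a) (suc b) ≡
             e (suc a ℕ.+ suc b) + c (suc a) (suc a ℕ.+ suc b) + c (suc a ℕ.+ suc b) (suc b))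
    (c-diag : ∀ a → + suc a * c (suc a) (suc a) ≡ (n - + suc a) * e (suc a))
    (c≡0ʳ : ∀ a b → M < b → c a b ≡ 0ℤ)
    (c≡0ˡ : ∀ a b → M < a → c a b ≡ 0ℤ)
    (e≡0 : ∀ d → M < d → e d ≡ 0ℤ)
    where

    moment : ℕ → ℤ
    moment k = sumTo M (λ d → (+ d) ^ k * e d)

    moment² : ℕ → ℕ → ℤ
    moment² i j = sumTo² M (λ a b → (+ a) ^ i * (+ b) ^ j * c a b)

    -- F (m, D) is the closed form of ∑_{a ≤ m} g (a, D - a).
    moments : ∀ (g h F : Polynomial 2) (k : Polynomial 1) i j z zs →
      g ≋ h ⟪ var 0F ∷ var 0F :+ var 1F ∷ [] ⟫ →
      g ≋ h ⟪ var 0F :+ var 1F ∷ var 1F ∷ [] ⟫ →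
      h ⟪ var 0F ∷ var 0F ∷ [] ⟫ ≋ k :* var 0F →
      g :- h ≋ con z :* (var 0F :^ i :* var 1F :^ j :+ var 0F :^ j :* var 1F :^ i) →
      F ⟪ con 0ℤ ∷ var 1F ∷ [] ⟫ ≋ con 0ℤ →
      F :+ g ⟪ con 1ℤ :+ var 0F ∷ var 1F :- (con 1ℤ :+ var 0F) ∷ [] ⟫ ≋ F ⟪ con 1ℤ :+ var 0F ∷ var 1F ∷ [] ⟫ →
      F ⟪ var 0F ∷ con 1ℤ :+ var 0F ∷ [] ⟫ :- k ⟪ con 1ℤ :+ var 0F ∷ [] ⟫ :* (var 1F :- (con 1ℤ :+ var 0F))
        ≋ combinationₚ (var 1F) zs (con 1ℤ :+ var 0F) →
      z * (moment² i j + moment² j i) ≡ combination n zs moment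
    moments g h F k i j z zs g≋hʳ g≋hˡ h≋k g-h≋z F0≋0 F+g≋F F≋zs = begin
      z * (moment² i j + moment² j i)
        ≡⟨ cong (z *_) (sumTo²-+ M (term i j) (term j i)) ⟨
      z * sumTo² M (λ a b → term i j a b + term j i a b)
        ≡⟨ sumTo²-*ˡ M z (λ a b → term i j a b + term j i a b) ⟨
      sumTo² M (λ a b → z * (term i j a b + term j i a b))
        ≡⟨ sumTo²-cong M (λ a b → trans
             (lemma z ((+ suc a) ^ i * (+ suc b) ^ j) ((+ suc a) ^ j * (+ suc b) ^ i) (c (suc a) (suc b)))
             (cong (_* c (suc a) (suc b)) (sym (≋⇒≡ g-h≋z (+ suc a ∷ + suc b ∷ []))))) ⟩
      sumTo² M (λ a b → (eval₂ g (+ a) (+ b) - eval₂ h (+ a) (+ b)) * c a b)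
        ≡⟨ skoruppa M c e c-rec c≡0ʳ c≡0ˡ e≡0 (eval₂ g) (eval₂ h)
             (λ x y → trans (≋⇒≡ g≋hʳ (x ∷ y ∷ [])) (⟦⟧-⟪⟫ h (var 0F ∷ var 0F :+ var 1F ∷ []) (x ∷ y ∷ [])))
             (λ x y → trans (≋⇒≡ g≋hˡ (x ∷ y ∷ [])) (⟦⟧-⟪⟫ h (var 0F :+ var 1F ∷ var 1F ∷ []) (x ∷ y ∷ []))) ⟩
      sumTo M (λ d → G d * e d) - sumTo M (λ a → eval₂ h (+ a) (+ a) * c a a)
        ≡⟨ cong (_-_ (sumTo M (λ d → G d * e d))) (sumTo-cong M diagonal) ⟩
      sumTo M (λ d → G d * e d) - sumTo M (λ d → κ d * (n - + d) * e d)
        ≡⟨ sumTo-minus M (λ d → G d * e d) (λ d → κ d * (n - + d) * e d) ⟨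
      sumTo M (λ d → G d * e d - κ d * (n - + d) * e d)
        ≡⟨ sumTo-cong M (λ d → trans (lemma₂ (G (suc d)) (κ (suc d) * (n - + suc d)) (e (suc d)))
             (cong (_* e (suc d)) (G-value d))) ⟩
      sumTo M (λ d → combination n zs ((+ d) ^_) * e d)
        ≡⟨ sumTo-combination M n zs (λ d → (+ d) ^_) e ⟩
      combination n zs moment ∎
      where
      term : ℕ → ℕ → ℕ → ℕ → ℤ
      term i j a b = (+ a) ^ i * (+ b) ^ j * c a b
      G κ : ℕ → ℤ
      G d = sumTo (d ∸ 1) (λ a → eval₂ g (+ a) (+ d - + a))
      κ d = ⟦ k ⟧ (+ d ∷ [])
      lemma : ∀ z x y c → z * (x * c + y * c) ≡ z * (x + y) * c
      lemma = solve-∀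
      lemma₂ : ∀ x y e → x * e - y * e ≡ (x - y) * e
      lemma₂ = solve-∀
      -- The diagonal value of `c` is known only after multiplication by a; the factorisation of h
      -- (x, x) as k (x) · x supplies that factor.
      diagonal : ∀ a → eval₂ h (+ suc a) (+ suc a) * c (suc a) (suc a) ≡ κ (suc a) * (n - + suc a) * e (suc a)
      diagonal a = begin
        eval₂ h (+ suc a) (+ suc a) * c (suc a) (suc a)
          ≡⟨ cong (_* c (suc a) (suc a)) (trans
               (sym (⟦⟧-⟪⟫ h (var 0F ∷ var 0F ∷ []) (+ suc a ∷ [])))
               (≋⇒≡ h≋k (+ suc a ∷ []))) ⟩
        κ (suc a) * + suc a * c (suc a) (suc a)   ≡⟨ ℤ.*-assoc (κ (suc a)) (+ suc a) (c (suc a) (suc a)) ⟩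
        κ (suc a) * (+ suc a * c (suc a) (suc a)) ≡⟨ cong (κ (suc a) *_) (c-diag a) ⟩
        κ (suc a) * ((n - + suc a) * e (suc a))   ≡⟨ ℤ.*-assoc (κ (suc a)) (n - + suc a) (e (suc a)) ⟨
        κ (suc a) * (n - + suc a) * e (suc a)     ∎
      -- The divisor is written 1 + d, and the inner sum runs over a < 1 + d: hence the arguments d
      -- and 1 + d of `F`.
      G-value : ∀ d → G (suc d) - κ (suc d) * (n - + suc d) ≡ combination n zs ((+ suc d) ^_)
      G-value d = begin
        G (suc d) - κ (suc d) * (n - + suc d)
          ≡⟨ cong₂ (λ x y → x - y * (n - + suc d))
               (trans (sumTo-polynomial g F F0≋0 F+g≋F (+ suc d) d)
                 (sym (⟦⟧-⟪⟫ F (var 0F ∷ con 1ℤ :+ var 0F ∷ []) ρ)))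
               (sym (⟦⟧-⟪⟫ k (con 1ℤ :+ var 0F ∷ []) ρ)) ⟩
        ⟦ F ⟪ var 0F ∷ con 1ℤ :+ var 0F ∷ [] ⟫ ⟧ ρ - ⟦ k ⟪ con 1ℤ :+ var 0F ∷ [] ⟫ ⟧ ρ * (n - + suc d)
          ≡⟨ ≋⇒≡ F≋zs ρ ⟩
        ⟦ combinationₚ (var 1F) zs (con 1ℤ :+ var 0F) ⟧ ρ
          ≡⟨ ⟦combinationₚ⟧ (var 1F) zs (con 1ℤ :+ var 0F) ρ ⟩
        combination n zs ((+ suc d) ^_) ∎
        where
        ρ = + d ∷ n ∷ []

    -- Here g - h = 6 (N - Φ) = 12 x y. The factors 6, 30 and 42, here and below, are the
    -- denominators of the Bernoulli numbers B₂, B₄, B₆; they make the closed form `F` of the sum of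
    -- powers integral.
    moments₁₁ : + 6 * (moment² 1 1 + moment² 1 1) ≡ combination n ((+ 5 , 0ℤ , 3) ∷ (+ 1 , - + 6 , 1) ∷ []) moment
    moments₁₁ = moments g h F (con (+ 6) :* var 0F) 1 1 (+ 6) ((+ 5 , 0ℤ , 3) ∷ (+ 1 , - + 6 , 1) ∷ [])
      (normal refl) (normal refl) (normal refl) (normal refl) (normal refl) (normal refl) (normal refl)
      where
      g h F : Polynomial 2
      g = let x = var 0F ; y = var 1F in con (+ 6) :* N x y
      h = let x = var 0F ; y = var 1F in con (+ 6) :* Φ x y
      F = let m = var 0F ; D = var 1F in
          con (+ 2) :* m :^ 3 :- con (+ 3) :* m :^ 2 :* D :+ con (+ 3) :* m :^ 2 :+ con (+ 6) :* m :* D :^ 2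
          :- con (+ 3) :* m :* D :+ m

    -- N² - Φ² = (N - Φ) (N + Φ) = 2 x y · 2 (x² + y²), which contains no other monomials than x³y
    -- and x y³.
    moments₁₃ : + 120 * (moment² 1 3 + moment² 3 1) ≡
      combination n ((+ 21 , 0ℤ , 5) ∷ (+ 10 , - + 30 , 3) ∷ (- + 1 , 0ℤ , 1) ∷ []) moment
    moments₁₃ = moments g h F (con (+ 30) :* var 0F :^ 3) 1 3 (+ 120)
      ((+ 21 , 0ℤ , 5) ∷ (+ 10 , - + 30 , 3) ∷ (- + 1 , 0ℤ , 1) ∷ [])
      (normal refl) (normal refl) (normal refl) (normal refl) (normal refl) (normal refl) (normal refl)
      where
      g h F : Polynomial 2
      g = let x = var 0F ; y = var 1F in con (+ 30) :* N x y :^ 2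
      h = let x = var 0F ; y = var 1F in con (+ 30) :* Φ x y :^ 2
      F = let m = var 0F ; D = var 1F in
          con (+ 6) :* m :^ 5 :- con (+ 15) :* m :^ 4 :* D :+ con (+ 15) :* m :^ 4 :+ con (+ 30) :* m :^ 3 :* D :^ 2
          :- con (+ 30) :* m :^ 3 :* D :+ con (+ 10) :* m :^ 3 :- con (+ 30) :* m :^ 2 :* D :^ 3 :+ con (+ 45) :* m :^ 2 :* D :^ 2
          :- con (+ 15) :* m :^ 2 :* D :+ con (+ 30) :* m :* D :^ 4 :- con (+ 30) :* m :* D :^ 3 :+ con (+ 15) :* m :* D :^ 2
          :- m

    -- K - Ψ = 4 x³y³. Since Ψ vanishes for x = y, the diagonal contributes nothing and no
    -- derivative appears in the result. K (a, D - a) = D² a² (D - a)² has degree 4 in a, so 30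
    -- suffices.
    moments₃₃ : + 60 * (moment² 3 3 + moment² 3 3) ≡ combination n ((+ 1 , 0ℤ , 7) ∷ (- + 1 , 0ℤ , 3) ∷ []) moment
    moments₃₃ = moments g h F (con (+ 0)) 3 3 (+ 60) ((+ 1 , 0ℤ , 7) ∷ (- + 1 , 0ℤ , 3) ∷ [])
      (normal refl) (normal refl) (normal refl) (normal refl) (normal refl) (normal refl) (normal refl)
      where
      g h F : Polynomial 2
      g = let x = var 0F ; y = var 1F in con (+ 30) :* K x y
      h = let x = var 0F ; y = var 1F in con (+ 30) :* Ψ x y
      F = let m = var 0F ; D = var 1F in
          con (+ 6) :* m :^ 5 :* D :^ 2 :- con (+ 15) :* m :^ 4 :* D :^ 3 :+ con (+ 15) :* m :^ 4 :* D :^ 2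
          :+ con (+ 10) :* m :^ 3 :* D :^ 4 :- con (+ 30) :* m :^ 3 :* D :^ 3 :+ con (+ 10) :* m :^ 3 :* D :^ 2
          :+ con (+ 15) :* m :^ 2 :* D :^ 4 :- con (+ 15) :* m :^ 2 :* D :^ 3 :+ con (+ 5) :* m :* D :^ 4 :- m :* D :^ 2

    -- In 2 N³ - 7 K the monomial x³y³ of g - h cancels.
    moments₁₅ : + 504 * (moment² 1 5 + moment² 5 1) ≡
      combination n ((+ 40 , 0ℤ , 7) ∷ (+ 42 , - + 84 , 5) ∷ (+ 2 , 0ℤ , 1) ∷ []) moment
    moments₁₅ = moments g h F (con (+ 84) :* var 0F :^ 5) 1 5 (+ 504)
      ((+ 40 , 0ℤ , 7) ∷ (+ 42 , - + 84 , 5) ∷ (+ 2 , 0ℤ , 1) ∷ [])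
      (normal refl) (normal refl) (normal refl) (normal refl) (normal refl) (normal refl) (normal refl)
      where
      g h F : Polynomial 2
      g = let x = var 0F ; y = var 1F in con (+ 42) :* (con (+ 2) :* N x y :^ 3 :- con (+ 7) :* K x y)
      h = let x = var 0F ; y = var 1F in con (+ 42) :* (con (+ 2) :* Φ x y :^ 3 :- con (+ 7) :* Ψ x y)
      F = let m = var 0F ; D = var 1F in
          con (+ 12) :* m :^ 7 :- con (+ 42) :* m :^ 6 :* D :+ con (+ 42) :* m :^ 6 :+ con (+ 42) :* m :^ 5 :* D :^ 2
          :- con (+ 126) :* m :^ 5 :* D :+ con (+ 42) :* m :^ 5 :+ con (+ 105) :* m :^ 4 :* D :^ 2 :- con (+ 105) :* m :^ 4 :* D
          :+ con (+ 70) :* m :^ 3 :* D :^ 4 :+ con (+ 70) :* m :^ 3 :* D :^ 2 :- con (+ 14) :* m :^ 3 :- con (+ 126) :* m :^ 2 :* D :^ 5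
          :+ con (+ 105) :* m :^ 2 :* D :^ 4 :+ con (+ 21) :* m :^ 2 :* D :+ con (+ 84) :* m :* D :^ 6 :- con (+ 126) :* m :* D :^ 5
          :+ con (+ 35) :* m :* D :^ 4 :- con (+ 7) :* m :* D :^ 2 :+ con (+ 2) :* m

-- Derivations on a commutative ring: geometric series, logarithmic derivatives, Ramanujan's
-- equations.

module DifferentialRing {c ℓ} (R : CommutativeRing c ℓ)
  (constants : CommutativeRing.rawRing ℤ.+-*-commutativeRing -Raw-AlmostCommutative⟶ fromCommutativeRing R)
  where

  open import Data.Integer.Base using (ℤ; +_; 0ℤ; 1ℤ) renaming (-_ to -ℤ_; _+_ to _+ℤ_)
  open CommutativeRing R renaming (refl to ≈-refl; sym to ≈-sym; trans to ≈-trans)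
  open ≈-Reasoning setoid
  open _-Raw-AlmostCommutative⟶_ constants renaming (⟦_⟧ to ι)

  ι≟ : WeaklyDecidable (Induced-equivalence constants)
  ι≟ x y = Maybe.map (λ { refl → ≈-refl }) (dec⇒weaklyDec ℤ._≟_ x y)

  open RingSolver (CommutativeRing.rawRing ℤ.+-*-commutativeRing) (fromCommutativeRing R) constants ι≟

  module Derivation (D : Carrier → Carrier) (D-cong : ∀ {x y} → x ≈ y → D x ≈ D y)
    (D-+ : ∀ x y → D (x + y) ≈ D x + D y) (D-* : ∀ x y → D (x * y) ≈ D x * y + x * D y)
    (D-ι : ∀ z → D (ι z) ≈ 0#)
    where

    D-ι* : ∀ z x → D (ι z * x) ≈ ι z * D x
    D-ι* z x = begin
      D (ι z * x)               ≈⟨ D-* (ι z) x ⟩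
      D (ι z) * x + ι z * D x   ≈⟨ +-congʳ (*-congʳ (≈-trans (D-ι z) (≈-sym 0-homo))) ⟩
      ι 0ℤ * x + ι z * D x      ≈⟨ solve 2 (λ x y → con 0ℤ :* x :+ y := y) ≈-refl x (ι z * D x) ⟩
      ι z * D x                 ∎

    D-ι+ι* : ∀ z w x → D (ι z + ι w * x) ≈ ι w * D x
    D-ι+ι* z w x = begin
      D (ι z + ι w * x)       ≈⟨ D-+ (ι z) (ι w * x) ⟩
      D (ι z) + D (ι w * x)   ≈⟨ +-cong (D-ι z) (D-ι* w x) ⟩
      0# + ι w * D x          ≈⟨ +-identityˡ _ ⟩
      ι w * D x               ∎

    D-neg : ∀ x → D (- x) ≈ - D x
    D-neg x = begin
      D (- x)              ≈⟨ D-cong (solve 1 (λ x → :- x := con (-ℤ 1ℤ) :* x) ≈-refl x) ⟩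
      D (ι (-ℤ 1ℤ) * x)    ≈⟨ D-ι* (-ℤ 1ℤ) x ⟩
      ι (-ℤ 1ℤ) * D x      ≈⟨ solve 1 (λ x → con (-ℤ 1ℤ) :* x := :- x) ≈-refl (D x) ⟩
      - D x                ∎

    -- 1 + U + V = (1 + U) (1 + V) - U V and X Y (1 + U) (1 + V) = U V.
    geometric-* : ∀ {X Y U V W} → U ≈ X * (ι 1ℤ + U) → V ≈ Y * (ι 1ℤ + V) → W ≈ (X * Y) * (ι 1ℤ + W) →
                  U * V ≈ W + U * W + W * V
    geometric-* {X} {Y} {U} {V} {W} U≈ V≈ W≈ = begin
      U * V
        ≈⟨ solve 3 (λ U V W → U :* V := (con 1ℤ :+ W) :* (U :* V) :- W :* (U :* V)) ≈-refl U V W ⟩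
      (ι 1ℤ + W) * (U * V) + - (W * (U * V))
        ≈⟨ +-congʳ (*-congˡ (*-cong U≈ V≈)) ⟩
      (ι 1ℤ + W) * ((X * (ι 1ℤ + U)) * (Y * (ι 1ℤ + V))) + - (W * (U * V))
        ≈⟨ solve 5 (λ X Y U V W → (con 1ℤ :+ W) :* ((X :* (con 1ℤ :+ U)) :* (Y :* (con 1ℤ :+ V))) :- W :* (U :* V)
             := (X :* Y) :* (con 1ℤ :+ W) :* ((con 1ℤ :+ U) :* (con 1ℤ :+ V)) :- W :* (U :* V)) ≈-refl X Y U V W ⟩
      (X * Y) * (ι 1ℤ + W) * ((ι 1ℤ + U) * (ι 1ℤ + V)) + - (W * (U * V))
        ≈⟨ +-congʳ (*-congʳ W≈) ⟨
      W * ((ι 1ℤ + U) * (ι 1ℤ + V)) + - (W * (U * V))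
        ≈⟨ solve 3 (λ U V W → W :* ((con 1ℤ :+ U) :* (con 1ℤ :+ V)) :- W :* (U :* V)
             := W :+ U :* W :+ W :* V) ≈-refl U V W ⟩
      W + U * W + W * V ∎

    -- U stands for X / (1 - X), and X (1 + U) = U replaces division by 1 - X: multiplying D U = a U
    -- + X · D U by 1 + U produces U · D U on both sides, which cancels.
    D-geometric : ∀ {a X U} → D X ≈ a * X → U ≈ X * (ι 1ℤ + U) → D U ≈ a * (U * U + U)
    D-geometric {a} {X} {U} DX≈ U≈ = begin
      D U
        ≈⟨ solve 2 (λ D U → D := (con 1ℤ :+ U) :* D :- U :* D) ≈-refl (D U) U ⟩
      (ι 1ℤ + U) * D U + - (U * D U)
        ≈⟨ +-congʳ (*-congˡ DU) ⟩
      (ι 1ℤ + U) * (a * U + X * D U) + - (U * D U)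
        ≈⟨ solve 4 (λ a X U D → (con 1ℤ :+ U) :* (a :* U :+ X :* D) :- U :* D
             := a :* (U :* U :+ U) :+ X :* (con 1ℤ :+ U) :* D :- U :* D) ≈-refl a X U (D U) ⟩
      a * (U * U + U) + X * (ι 1ℤ + U) * D U + - (U * D U)
        ≈⟨ +-congʳ (+-congˡ (*-congʳ U≈)) ⟨
      a * (U * U + U) + U * D U + - (U * D U)
        ≈⟨ solve 3 (λ a U D → a :* (U :* U :+ U) :+ U :* D :- U :* D := a :* (U :* U :+ U)) ≈-refl a U (D U) ⟩
      a * (U * U + U) ∎
      where
      DU : D U ≈ a * U + X * D U
      DU = begin
        D U                                         ≈⟨ D-cong U≈ ⟩
        D (X * (ι 1ℤ + U))                          ≈⟨ D-* X (ι 1ℤ + U) ⟩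
        D X * (ι 1ℤ + U) + X * D (ι 1ℤ + U)         ≈⟨ +-cong (*-congʳ DX≈) (*-congˡ (≈-trans (D-+ (ι 1ℤ) U)
                                                         (≈-trans (+-congʳ (D-ι 1ℤ)) (+-identityˡ (D U))))) ⟩
        (a * X) * (ι 1ℤ + U) + X * D U              ≈⟨ +-congʳ (≈-trans (*-assoc a X (ι 1ℤ + U)) (*-congˡ (≈-sym U≈))) ⟩
        a * U + X * D U                             ∎

    -- `D f ≈ x * f` makes `x` a logarithmic derivative of `f` without dividing by `f`; such `x` add
    -- under products.
    logarithmic-* : ∀ {f g x y} → D f ≈ x * f → D g ≈ y * g → D (f * g) ≈ (x + y) * (f * g)
    logarithmic-* {f} {g} {x} {y} Df≈ Dg≈ = begin
      D (f * g)             ≈⟨ D-* f g ⟩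
      D f * g + f * D g     ≈⟨ +-cong (*-congʳ Df≈) (*-congˡ Dg≈) ⟩
      x * f * g + f * (y * g)
        ≈⟨ solve 4 (λ f g x y → x :* f :* g :+ f :* (y :* g) := (x :+ y) :* (f :* g)) ≈-refl f g x y ⟩
      (x + y) * (f * g)     ∎

    logarithmic-1 : ∀ x → D 1# ≈ (ι 0ℤ * x) * 1#
    logarithmic-1 x = begin
      D 1#                 ≈⟨ D-cong (1-homo) ⟨
      D (ι 1ℤ)             ≈⟨ D-ι 1ℤ ⟩
      0#                   ≈⟨ 0-homo ⟨
      ι 0ℤ                 ≈⟨ solve 1 (λ x → con 0ℤ := con 0ℤ :* x) ≈-refl x ⟩
      ι 0ℤ * x             ≈⟨ *-identityʳ (ι 0ℤ * x) ⟨
      (ι 0ℤ * x) * 1#      ∎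

    logarithmic-suc : ∀ {f g x} z → D f ≈ x * f → D g ≈ (ι z * x) * g → D (f * g) ≈ (ι (1ℤ +ℤ z) * x) * (f * g)
    logarithmic-suc {f} {g} {x} z Df≈ Dg≈ = begin
      D (f * g)                                ≈⟨ logarithmic-* Df≈ Dg≈ ⟩
      (x + ι z * x) * (f * g)
        ≈⟨ *-congʳ (solve 2 (λ w x → x :+ w :* x := (con 1ℤ :+ w) :* x) ≈-refl (ι z) x) ⟩
      ((ι 1ℤ + ι z) * x) * (f * g)
        ≈⟨ *-congʳ (*-congʳ (+-homo 1ℤ z)) ⟨
      (ι (1ℤ +ℤ z) * x) * (f * g)              ∎

    eigen-ι* : ∀ {p f} z → D f ≈ p * f → D (ι z * f) ≈ p * (ι z * f)
    eigen-ι* {p} {f} z Df≈ = begin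
      D (ι z * f)        ≈⟨ D-ι* z f ⟩
      ι z * D f          ≈⟨ *-congˡ Df≈ ⟩
      ι z * (p * f)      ≈⟨ solve 3 (λ z p f → z :* (p :* f) := p :* (z :* f)) ≈-refl (ι z) p f ⟩
      p * (ι z * f)      ∎

    eigen-minus : ∀ {p f g} → D f ≈ p * f → D g ≈ p * g → D (f + - g) ≈ p * (f + - g)
    eigen-minus {p} {f} {g} Df≈ Dg≈ = begin
      D (f + - g)          ≈⟨ D-+ f (- g) ⟩
      D f + D (- g)        ≈⟨ +-cong Df≈ (≈-trans (D-neg g) (-‿cong Dg≈)) ⟩
      p * f + - (p * g)    ≈⟨ solve 3 (λ p f g → p :* f :- p :* g := p :* (f :- g)) ≈-refl p f g ⟩
      p * (f + - g)        ∎

    D-1-X : ∀ {a X U} → D X ≈ a * X → U ≈ X * (ι 1ℤ + U) → D (ι 1ℤ + - X) ≈ - (a * U) * (ι 1ℤ + - X)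
    D-1-X {a} {X} {U} DX≈ U≈ = begin
      D (ι 1ℤ + - X)             ≈⟨ D-+ (ι 1ℤ) (- X) ⟩
      D (ι 1ℤ) + D (- X)         ≈⟨ +-cong (D-ι 1ℤ) (≈-trans (D-neg X) (-‿cong DX≈)) ⟩
      0# + - (a * X)             ≈⟨ +-identityˡ _ ⟩
      - (a * X)
        ≈⟨ solve 3 (λ a X U → :- (a :* X) := :- (a :* (X :* (con 1ℤ :+ U))) :+ a :* U :* X) ≈-refl a X U ⟩
      - (a * (X * (ι 1ℤ + U))) + a * U * X
        ≈⟨ +-congʳ (-‿cong (*-congˡ U≈)) ⟨
      - (a * U) + a * U * X
        ≈⟨ solve 3 (λ a X U → :- (a :* U) :+ a :* U :* X := :- (a :* U) :* (con 1ℤ :- X)) ≈-refl a X U ⟩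
      - (a * U) * (ι 1ℤ + - X)   ∎

    private
      -- The way hypotheses are fed to the solver: it proves an identity in free variables that
      -- carries `w` times the difference of the two sides of a hypothesis, and this term is then
      -- dropped. The cofactor is forced by the quadratic terms; in `DP` it is -48, as 24² = 48 ·
      -- 12.
      modify : ∀ {x y} z w → x ≈ y → z + w * (x + - y) ≈ z
      modify {x} {y} z w x≈y = ≈-trans (+-congˡ (*-congˡ (+-congʳ x≈y)))
        (solve 3 (λ y z w → z :+ w :* (y :- y) := z) ≈-refl y z w)

    module Ramanujan (E₁ E₃ E₅ E₇ : Carrier)
      (E₁E₁ : ι (+ 6) * (E₁ * E₁ + E₁ * E₁) ≈ ι (+ 5) * E₃ + E₁ + - (ι (+ 6) * D E₁))
      (E₁E₃ : ι (+ 120) * (E₁ * E₃ + E₃ * E₁) ≈ ι (+ 21) * E₅ + ι (+ 10) * E₃ + - (ι (+ 30) * D E₃) + - E₁)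
      (E₃E₃ : ι (+ 60) * (E₃ * E₃ + E₃ * E₃) ≈ E₇ + - E₃)
      (E₁E₅ : ι (+ 504) * (E₁ * E₅ + E₅ * E₁) ≈ ι (+ 40) * E₇ + ι (+ 42) * E₅ + - (ι (+ 84) * D E₅) + ι (+ 2) * E₁)
      where

      -- The Eisenstein series of weights 2, 4, 6 normalised to constant term 1; -24, 240 and -504
      -- are -2k / B_k for k = 2, 4, 6. `Δ` is 1728 times the usual discriminant form.
      P Q R′ Δ : Carrier
      P = ι 1ℤ + ι (-ℤ (+ 24)) * E₁
      Q = ι 1ℤ + ι (+ 240) * E₃
      R′ = ι 1ℤ + ι (-ℤ (+ 504)) * E₅
      Δ = Q * Q * Q + - (R′ * R′)

      DP : ι (+ 12) * D P ≈ P * P + - Q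
      DP = begin
        ι (+ 12) * D P
          ≈⟨ *-congˡ (D-ι+ι* 1ℤ (-ℤ (+ 24)) E₁) ⟩
        ι (+ 12) * (ι (-ℤ (+ 24)) * D E₁)
          ≈⟨ solve 3 (λ x z d → con (+ 12) :* (con (-ℤ (+ 24)) :* d)
               := (con 1ℤ :+ con (-ℤ (+ 24)) :* x) :* (con 1ℤ :+ con (-ℤ (+ 24)) :* x) :- (con 1ℤ :+ con (+ 240) :* z)
                  :+ con (-ℤ (+ 48)) :* (con (+ 6) :* (x :* x :+ x :* x) :- (con (+ 5) :* z :+ x :- con (+ 6) :* d)))
               ≈-refl E₁ E₃ (D E₁) ⟩
        P * P + - Q + ι (-ℤ (+ 48)) * (ι (+ 6) * (E₁ * E₁ + E₁ * E₁) + - (ι (+ 5) * E₃ + E₁ + - (ι (+ 6) * D E₁)))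
          ≈⟨ modify (P * P + - Q) (ι (-ℤ (+ 48))) E₁E₁ ⟩
        P * P + - Q ∎

      DQ : ι (+ 3) * D Q ≈ P * Q + - R′
      DQ = begin
        ι (+ 3) * D Q
          ≈⟨ *-congˡ (D-ι+ι* 1ℤ (+ 240) E₃) ⟩
        ι (+ 3) * (ι (+ 240) * D E₃)
          ≈⟨ solve 4 (λ x z w d → con (+ 3) :* (con (+ 240) :* d)
               := (con 1ℤ :+ con (-ℤ (+ 24)) :* x) :* (con 1ℤ :+ con (+ 240) :* z) :- (con 1ℤ :+ con (-ℤ (+ 504)) :* w)
                  :+ con (+ 24) :* (con (+ 120) :* (x :* z :+ z :* x)
                     :- (con (+ 21) :* w :+ con (+ 10) :* z :- con (+ 30) :* d :- x)))
               ≈-refl E₁ E₃ E₅ (D E₃) ⟩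
        P * Q + - R′ + ι (+ 24) * (ι (+ 120) * (E₁ * E₃ + E₃ * E₁)
          + - (ι (+ 21) * E₅ + ι (+ 10) * E₃ + - (ι (+ 30) * D E₃) + - E₁))
          ≈⟨ modify (P * Q + - R′) (ι (+ 24)) E₁E₃ ⟩
        P * Q + - R′ ∎

      -- The relation for `E₁ * E₅` brings in `E₇`, of weight 8. The relation for `E₃ * E₃`
      -- eliminates it in favour of `Q * Q`: the two contributions 12 · 40 and 480 cancel.
      DR : ι (+ 2) * D R′ ≈ P * R′ + - (Q * Q)
      DR = begin
        ι (+ 2) * D R′
          ≈⟨ *-congˡ (D-ι+ι* 1ℤ (-ℤ (+ 504)) E₅) ⟩
        ι (+ 2) * (ι (-ℤ (+ 504)) * D E₅)
          ≈⟨ solve 5 (λ x z w t d → con (+ 2) :* (con (-ℤ (+ 504)) :* d)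
               := (con 1ℤ :+ con (-ℤ (+ 24)) :* x) :* (con 1ℤ :+ con (-ℤ (+ 504)) :* w)
                  :- (con 1ℤ :+ con (+ 240) :* z) :* (con 1ℤ :+ con (+ 240) :* z)
                  :+ con (-ℤ (+ 12)) :* (con (+ 504) :* (x :* w :+ w :* x)
                     :- (con (+ 40) :* t :+ con (+ 42) :* w :- con (+ 84) :* d :+ con (+ 2) :* x))
                  :+ con (+ 480) :* (con (+ 60) :* (z :* z :+ z :* z) :- (t :- z)))
               ≈-refl E₁ E₃ E₅ E₇ (D E₅) ⟩
        P * R′ + - (Q * Q)
          + ι (-ℤ (+ 12)) * (ι (+ 504) * (E₁ * E₅ + E₅ * E₁)
            + - (ι (+ 40) * E₇ + ι (+ 42) * E₅ + - (ι (+ 84) * D E₅) + ι (+ 2) * E₁))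
          + ι (+ 480) * (ι (+ 60) * (E₃ * E₃ + E₃ * E₃) + - (E₇ + - E₃))
          ≈⟨ modify _ (ι (+ 480)) E₃E₃ ⟩
        P * R′ + - (Q * Q)
          + ι (-ℤ (+ 12)) * (ι (+ 504) * (E₁ * E₅ + E₅ * E₁)
            + - (ι (+ 40) * E₇ + ι (+ 42) * E₅ + - (ι (+ 84) * D E₅) + ι (+ 2) * E₁))
          ≈⟨ modify _ (ι (-ℤ (+ 12))) E₁E₅ ⟩
        P * R′ + - (Q * Q) ∎

      -- In Q² · 3 D Q - R · 2 D R the mixed terms Q² R of the two Ramanujan equations cancel, and P
      -- is left as a common factor.
      DΔ : D Δ ≈ P * Δ
      DΔ = begin
        D (Q * Q * Q + - (R′ * R′))
          ≈⟨ D-+ (Q * Q * Q) (- (R′ * R′)) ⟩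
        D (Q * Q * Q) + D (- (R′ * R′))
          ≈⟨ +-cong (≈-trans (D-* (Q * Q) Q) (+-congʳ (*-congʳ (D-* Q Q)))) (≈-trans (D-neg (R′ * R′)) (-‿cong (D-* R′ R′))) ⟩
        (D Q * Q + Q * D Q) * Q + Q * Q * D Q + - (D R′ * R′ + R′ * D R′)
          ≈⟨ solve 4 (λ q dq r dr → (dq :* q :+ q :* dq) :* q :+ q :* q :* dq :- (dr :* r :+ r :* dr)
               := q :* q :* (con (+ 3) :* dq) :- r :* (con (+ 2) :* dr)) ≈-refl Q (D Q) R′ (D R′) ⟩
        Q * Q * (ι (+ 3) * D Q) + - (R′ * (ι (+ 2) * D R′))
          ≈⟨ +-cong (*-congˡ DQ) (-‿cong (*-congˡ DR)) ⟩
        Q * Q * (P * Q + - R′) + - (R′ * (P * R′ + - (Q * Q)))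
          ≈⟨ solve 3 (λ p q r → q :* q :* (p :* q :- r) :- r :* (p :* r :- q :* q)
               := p :* (q :* q :* q :- r :* r)) ≈-refl P Q R′ ⟩
        P * Δ ∎

      DDQ : ι (+ 3) * D (D Q) ≈ D P * Q + P * D Q + - D R′
      DDQ = begin
        ι (+ 3) * D (D Q)             ≈⟨ D-ι* (+ 3) (D Q) ⟨
        D (ι (+ 3) * D Q)             ≈⟨ D-cong DQ ⟩
        D (P * Q + - R′)              ≈⟨ D-+ (P * Q) (- R′) ⟩
        D (P * Q) + D (- R′)          ≈⟨ +-cong (D-* P Q) (D-neg R′) ⟩
        D P * Q + P * D Q + - D R′    ∎

      -- The second Rankin–Cohen bracket of Q with itself.
      bracket : ι (+ 144) * (Q * D (D Q)) + - (ι (+ 180) * (D Q * D Q)) ≈ ι (+ 20) * Δ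
      bracket = begin
        ι (+ 144) * (Q * D (D Q)) + - (ι (+ 180) * (D Q * D Q))
          ≈⟨ solve 3 (λ q dq ddq → con (+ 144) :* (q :* ddq) :- con (+ 180) :* (dq :* dq)
               := con (+ 48) :* q :* (con (+ 3) :* ddq) :- con (+ 20) :* ((con (+ 3) :* dq) :* (con (+ 3) :* dq)))
               ≈-refl Q (D Q) (D (D Q)) ⟩
        ι (+ 48) * Q * (ι (+ 3) * D (D Q)) + - (ι (+ 20) * ((ι (+ 3) * D Q) * (ι (+ 3) * D Q)))
          ≈⟨ +-cong (*-congˡ DDQ) (-‿cong (*-congˡ (*-cong DQ DQ))) ⟩
        ι (+ 48) * Q * (D P * Q + P * D Q + - D R′) + - (ι (+ 20) * ((P * Q + - R′) * (P * Q + - R′)))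
          ≈⟨ solve 6 (λ p q r dp dq dr →
               con (+ 48) :* q :* (dp :* q :+ p :* dq :- dr) :- con (+ 20) :* ((p :* q :- r) :* (p :* q :- r))
               := con (+ 4) :* q :* q :* (con (+ 12) :* dp) :+ con (+ 16) :* p :* q :* (con (+ 3) :* dq)
                  :- con (+ 24) :* q :* (con (+ 2) :* dr) :- con (+ 20) :* ((p :* q :- r) :* (p :* q :- r)))
               ≈-refl P Q R′ (D P) (D Q) (D R′) ⟩
        ι (+ 4) * Q * Q * (ι (+ 12) * D P) + ι (+ 16) * P * Q * (ι (+ 3) * D Q)
          + - (ι (+ 24) * Q * (ι (+ 2) * D R′)) + - (ι (+ 20) * ((P * Q + - R′) * (P * Q + - R′)))
          ≈⟨ +-congʳ (+-cong (+-cong (*-congˡ DP) (*-congˡ DQ)) (-‿cong (*-congˡ DR))) ⟩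
        ι (+ 4) * Q * Q * (P * P + - Q) + ι (+ 16) * P * Q * (P * Q + - R′)
          + - (ι (+ 24) * Q * (P * R′ + - (Q * Q))) + - (ι (+ 20) * ((P * Q + - R′) * (P * Q + - R′)))
          ≈⟨ solve 3 (λ p q r → con (+ 4) :* q :* q :* (p :* p :- q) :+ con (+ 16) :* p :* q :* (p :* q :- r)
               :- con (+ 24) :* q :* (p :* r :- q :* q) :- con (+ 20) :* ((p :* q :- r) :* (p :* q :- r))
               := con (+ 20) :* (q :* q :* q :- r :* r)) ≈-refl P Q R′ ⟩
        ι (+ 20) * Δ ∎

      -- The relation for `E₃ * E₃` differentiated twice. It trades E₃ · D D E₃ for (D E₃)² and D D
      -- E₇, in the passage from the bracket to (i) and again in that from (i) to (ii).
      DDE₃² : ι (+ 120) * (D E₃ * D E₃ + D (D E₃) * E₃ + (D E₃ * D E₃ + D (D E₃) * E₃)) ≈ D (D E₇) + - D (D E₃)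
      DDE₃² = begin
        ι (+ 120) * (D E₃ * D E₃ + D (D E₃) * E₃ + (D E₃ * D E₃ + D (D E₃) * E₃))
          ≈⟨ solve 3 (λ z dz ddz → con (+ 120) :* (dz :* dz :+ ddz :* z :+ (dz :* dz :+ ddz :* z))
               := con (+ 60) :* ((ddz :* z :+ dz :* dz) :+ (dz :* dz :+ z :* ddz)
                  :+ ((ddz :* z :+ dz :* dz) :+ (dz :* dz :+ z :* ddz)))) ≈-refl E₃ (D E₃) (D (D E₃)) ⟩
        ι (+ 60) * (s + s)
          ≈⟨ *-congˡ (+-cong DDzz DDzz) ⟨
        ι (+ 60) * (D (D (E₃ * E₃)) + D (D (E₃ * E₃)))
          ≈⟨ *-congˡ (≈-trans (D-cong (D-+ (E₃ * E₃) (E₃ * E₃))) (D-+ (D (E₃ * E₃)) (D (E₃ * E₃)))) ⟨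
        ι (+ 60) * D (D (E₃ * E₃ + E₃ * E₃))
          ≈⟨ ≈-trans (D-cong (D-ι* (+ 60) (E₃ * E₃ + E₃ * E₃))) (D-ι* (+ 60) (D (E₃ * E₃ + E₃ * E₃))) ⟨
        D (D (ι (+ 60) * (E₃ * E₃ + E₃ * E₃)))
          ≈⟨ D-cong (D-cong E₃E₃) ⟩
        D (D (E₇ + - E₃))
          ≈⟨ D-cong (≈-trans (D-+ E₇ (- E₃)) (+-congˡ (D-neg E₃))) ⟩
        D (D E₇ + - D E₃)
          ≈⟨ ≈-trans (D-+ (D E₇) (- D E₃)) (+-congˡ (D-neg (D E₃))) ⟩
        D (D E₇) + - D (D E₃) ∎
        where
        s = (D (D E₃) * E₃ + D E₃ * D E₃) + (D E₃ * D E₃ + E₃ * D (D E₃))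
        DDzz : D (D (E₃ * E₃)) ≈ s
        DDzz = begin
          D (D (E₃ * E₃))              ≈⟨ D-cong (D-* E₃ E₃) ⟩
          D (D E₃ * E₃ + E₃ * D E₃)    ≈⟨ D-+ (D E₃ * E₃) (E₃ * D E₃) ⟩
          D (D E₃ * E₃) + D (E₃ * D E₃) ≈⟨ +-cong (D-* (D E₃) E₃) (D-* E₃ (D E₃)) ⟩
          s ∎

      -- The right-hand side of (i) as a series.
      Γ : Carrier
      Γ = D (D E₇) + - (ι (+ 540) * (D E₃ * D E₃))

      -- 34560 is both 20 · 1728 and 144 · 240, the coefficient of D D E₃ in the bracket. After
      -- division by it, (D Q)² contributes -300 (D E₃)², and eliminating E₃ · D D E₃ by `DDE₃²`
      -- another -240: this is the 540 of (i).
      cusp-form : ∀ {T} → ι (+ 1728) * T ≈ Δ → ι (+ 34560) * T ≈ ι (+ 34560) * Γ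
      cusp-form {T} T≈ = begin
        ι (+ 34560) * T
          ≈⟨ solve 1 (λ t → con (+ 34560) :* t := con (+ 20) :* (con (+ 1728) :* t)) ≈-refl T ⟩
        ι (+ 20) * (ι (+ 1728) * T)
          ≈⟨ *-congˡ T≈ ⟩
        ι (+ 20) * Δ
          ≈⟨ bracket ⟨
        ι (+ 144) * (Q * D (D Q)) + - (ι (+ 180) * (D Q * D Q))
          ≈⟨ +-cong (*-congˡ (*-congˡ (≈-trans (D-cong (D-ι+ι* 1ℤ (+ 240) E₃)) (D-ι* (+ 240) (D E₃)))))
               (-‿cong (*-congˡ (*-cong (D-ι+ι* 1ℤ (+ 240) E₃) (D-ι+ι* 1ℤ (+ 240) E₃)))) ⟩
        ι (+ 144) * ((ι 1ℤ + ι (+ 240) * E₃) * (ι (+ 240) * D (D E₃)))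
          + - (ι (+ 180) * ((ι (+ 240) * D E₃) * (ι (+ 240) * D E₃)))
          ≈⟨ solve 4 (λ z dz ddz ddt →
               con (+ 144) :* ((con 1ℤ :+ con (+ 240) :* z) :* (con (+ 240) :* ddz))
                 :- con (+ 180) :* ((con (+ 240) :* dz) :* (con (+ 240) :* dz))
               := con (+ 34560) :* (ddt :- con (+ 540) :* (dz :* dz)) :+ con (+ 34560) :*
                 (con (+ 120) :* (dz :* dz :+ ddz :* z :+ (dz :* dz :+ ddz :* z)) :- (ddt :- ddz)))
               ≈-refl E₃ (D E₃) (D (D E₃)) (D (D E₇)) ⟩
        ι (+ 34560) * (D (D E₇) + - (ι (+ 540) * (D E₃ * D E₃))) + ι (+ 34560) *
          (ι (+ 120) * (D E₃ * D E₃ + D (D E₃) * E₃ + (D E₃ * D E₃ + D (D E₃) * E₃)) + - (D (D E₇) + - D (D E₃)))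
          ≈⟨ modify _ (ι (+ 34560)) DDE₃² ⟩
        ι (+ 34560) * (D (D E₇) + - (ι (+ 540) * (D E₃ * D E₃))) ∎

-- Lambert series of divisor sums, and the product defining τ.

module Eisenstein where

  open import Data.Integer.Base using (ℤ; +_; 0ℤ; 1ℤ; _+_; _-_; -_; _*_; ∣_∣)
  open Exp ℤ.+-*-semiring using (_^_)
  open PowerSeries
  open Summation
  open ≡-Reasoning

  q-⊛-suc : ∀ f n → (q ⊛ f) (suc n) ≡ f n
  q-⊛-suc f n = trans (ℤ.+-identityˡ ((q ∘ suc ⊛ f) n))
    (trans (⊛-congˡ (q ∘ suc) 𝟙 f (λ { zero → refl ; (suc _) → refl }) n) (⊛-identityˡ f n))

  q^-⊛-+ : ∀ a f n → (q ^ˢ a ⊛ f) (a ℕ.+ n) ≡ f n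
  q^-⊛-+ zero    f n = ⊛-identityˡ f n
  q^-⊛-+ (suc a) f n = trans (⊛-assoc q (q ^ˢ a) f (suc (a ℕ.+ n)))
    (trans (q-⊛-suc (q ^ˢ a ⊛ f) (a ℕ.+ n)) (q^-⊛-+ a f n))

  q^-⊛-< : ∀ a f n → n < a → (q ^ˢ a ⊛ f) n ≡ 0ℤ
  q^-⊛-< (suc a) f zero    _         = trans (⊛-assoc q (q ^ˢ a) f 0) refl
  q^-⊛-< (suc a) f (suc n) (s≤s n<a) = trans (⊛-assoc q (q ^ˢ a) f (suc n))
    (trans (q-⊛-suc (q ^ˢ a ⊛ f) n) (q^-⊛-< a f n n<a))

  indicator : ∀ {P : Set} → Dec P → ℤ
  indicator (yes _) = 1ℤ
  indicator (no _)  = 0ℤ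

  indicator-cong : ∀ {P Q : Set} (p : Dec P) (q : Dec Q) → (P → Q) → (Q → P) → indicator p ≡ indicator q
  indicator-cong (yes _) (yes _) _   _   = refl
  indicator-cong (yes p) (no ¬q) p⇒q _   = contradiction (p⇒q p) ¬q
  indicator-cong (no ¬p) (yes q) _   q⇒p = contradiction (q⇒p q) ¬p
  indicator-cong (no _)  (no _)  _   _   = refl

  indicator-no : ∀ {P : Set} (p : Dec P) → ¬ P → indicator p ≡ 0ℤ
  indicator-no (yes p) ¬p = contradiction p ¬p
  indicator-no (no _)  _  = refl

  -- The series qᵃ / (1 - qᵃ) for a ≥ 1. The constant term is set apart because every a divides 0.
  u : ℕ → Series
  u a zero    = 0ℤ
  u a (suc n) = indicator (a ∣? suc n)

  u-< : ∀ a n → n < a → u a n ≡ 0ℤ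
  u-< a zero    _   = refl
  u-< a (suc n) n<a = indicator-no (a ∣? suc n) (λ a∣n → ℕ.<⇒≱ n<a (∣⇒≤ a∣n))

  -- The geometric series as a fixed point of U = qᵃ (1 + U), so that no inverse series is needed.
  -- On coefficients: a divides n exactly if it divides n - a, and the summand 1 accounts for n = a.
  u-fixpoint : ∀ a → u (suc a) ≗ q ^ˢ suc a ⊛ (const 1ℤ ⊕ u (suc a))
  u-fixpoint a n with suc a ℕ.≤? n
  ... | no  a≰n = trans (u-< (suc a) n (ℕ.≰⇒> a≰n)) (sym (q^-⊛-< (suc a) (const 1ℤ ⊕ u (suc a)) n (ℕ.≰⇒> a≰n)))
  ... | yes a≤n = subst (λ n → u (suc a) n ≡ (q ^ˢ suc a ⊛ (const 1ℤ ⊕ u (suc a))) n) (ℕ.m+[n∸m]≡n a≤n)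
    (trans (shift (n ∸ suc a)) (sym (q^-⊛-+ (suc a) (const 1ℤ ⊕ u (suc a)) (n ∸ suc a))))
    where
    shift : ∀ k → u (suc a) (suc a ℕ.+ k) ≡ const 1ℤ k + u (suc a) k
    shift zero    = indicator-cong (suc a ∣? suc (a ℕ.+ 0)) (yes (∣-refl {suc a})) (λ _ → ∣-refl)
      (λ _ → subst (suc a ∣_) (sym (ℕ.+-identityʳ (suc a))) ∣-refl)
    shift (suc k) = trans
      (indicator-cong (suc a ∣? suc (a ℕ.+ suc k)) (suc a ∣? suc k)
        (λ d → ∣m+n∣m⇒∣n d ∣-refl) (∣m∣n⇒∣m+n ∣-refl))
      (sym (ℤ.+-identityˡ (u (suc a) (suc k))))

  D-⊕ : ∀ f g → D (f ⊕ g) ≗ D f ⊕ D g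
  D-⊕ f g n = ℤ.*-distribˡ-+ (+ n) (f n) (g n)

  D-cong : ∀ {f g} → f ≗ g → D f ≗ D g
  D-cong f≗g n = cong (+ n *_) (f≗g n)

  D-const : ∀ z → D (const z) ≗ const 0ℤ
  D-const z zero    = refl
  D-const z (suc n) = ℤ.*-zeroʳ (+ suc n)

  module ≗ = CommutativeRing Series-commutativeRing
  open DifferentialRing Series-commutativeRing const-homomorphism
  open Derivation D D-cong D-⊕ D-⊛ D-const public

  q^-+ : ∀ a b → q ^ˢ (a ℕ.+ b) ≗ q ^ˢ a ⊛ q ^ˢ b
  q^-+ zero    b n = sym (⊛-identityˡ (q ^ˢ b) n)
  q^-+ (suc a) b n = trans (⊛-congʳ q (q ^ˢ (a ℕ.+ b)) (q ^ˢ a ⊛ q ^ˢ b) (q^-+ a b) n)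
    (sym (⊛-assoc q (q ^ˢ a) (q ^ˢ b) n))

  D-^ˢ : ∀ {f x} → D f ≗ x ⊛ f → ∀ k → D (f ^ˢ k) ≗ (const (+ k) ⊛ x) ⊛ f ^ˢ k
  D-^ˢ {f} {x} Df zero    = logarithmic-1 x
  D-^ˢ {f} {x} Df (suc k) = logarithmic-suc {f} {f ^ˢ k} {x} (+ k) Df (D-^ˢ {f} {x} Df k)

  D-q : D q ≗ 𝟙 ⊛ q
  D-q n = trans (lemma n) (sym (⊛-identityˡ q n))
    where
    lemma : ∀ n → + n * q n ≡ q n
    lemma 0             = refl
    lemma 1             = refl
    lemma (suc (suc n)) = ℤ.*-zeroʳ (+ suc (suc n))

  D-q^ : ∀ a → D (q ^ˢ a) ≗ const (+ a) ⊛ q ^ˢ a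
  D-q^ a = ≗.trans (D-^ˢ {q} {𝟙} D-q a) (⊛-congˡ (const (+ a) ⊛ 𝟙) (const (+ a)) (q ^ˢ a) (≗.*-identityʳ (const (+ a))))

  u-⊛ : ∀ a b → u (suc a) ⊛ u (suc b) ≗
    u (suc a ℕ.+ suc b) ⊕ u (suc a) ⊛ u (suc a ℕ.+ suc b) ⊕ u (suc a ℕ.+ suc b) ⊛ u (suc b)
  u-⊛ a b = geometric-* {q ^ˢ suc a} {q ^ˢ suc b} {u (suc a)} {u (suc b)} {u (suc a ℕ.+ suc b)}
    (u-fixpoint a) (u-fixpoint b)
    (λ k → trans (u-fixpoint (a ℕ.+ suc b) k)
      (⊛-congˡ (q ^ˢ (suc a ℕ.+ suc b)) (q ^ˢ suc a ⊛ q ^ˢ suc b) (const 1ℤ ⊕ u (suc a ℕ.+ suc b)) (q^-+ (suc a) (suc b)) k))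

  -- The n-th coefficient of D U = a (U² + U). The factor n becomes the derivative of `E k` in the
  -- product formulas.
  u-diagonal : ∀ n a → + suc a * (u (suc a) ⊛ u (suc a)) n ≡ (+ n - + suc a) * u (suc a) n
  u-diagonal n a = begin
    A * U²               ≡⟨ lemma A U² U ⟩
    A * (U² + U) - A * U ≡⟨ cong (_- A * U) (const-⊛ A (u (suc a) ⊛ u (suc a) ⊕ u (suc a)) n) ⟨
    (const A ⊛ (u (suc a) ⊛ u (suc a) ⊕ u (suc a))) n - A * U
      ≡⟨ cong (_- A * U) (D-geometric {const A} {q ^ˢ suc a} {u (suc a)} (D-q^ (suc a)) (u-fixpoint a) n) ⟨
    + n * U - A * U      ≡⟨ lemma₂ (+ n) A U ⟩
    (+ n - A) * U        ∎
    where
    A = + suc a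
    U² = (u (suc a) ⊛ u (suc a)) n
    U = u (suc a) n
    lemma : ∀ a x y → a * x ≡ a * (x + y) - a * y
    lemma = solve-∀
    lemma₂ : ∀ n a x → n * x - a * x ≡ (n - a) * x
    lemma₂ = solve-∀

  u-⊛-<ʳ : ∀ n a b → n < b → (u a ⊛ u b) n ≡ 0ℤ
  u-⊛-<ʳ n a b n<b = trans (⊛-comm (u a) (u b) n) (trans
    (⊛-cong-≤ {u b} {λ _ → 0ℤ} {u a} {u a} n (λ k k≤n → u-< b k (ℕ.≤-<-trans k≤n n<b)) (λ _ _ → refl))
    (0-⊛ (u a) n))

  u-⊛-<ˡ : ∀ n a b → n < a → (u a ⊛ u b) n ≡ 0ℤ
  u-⊛-<ˡ n a b n<a = trans (⊛-comm (u a) (u b) n) (u-⊛-<ʳ n b a n<a)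

  sum-applyUpTo : ∀ (f : ℕ → ℕ) n → + sum (List.map f (applyUpTo suc n)) ≡ sumTo n (λ k → + f k)
  sum-applyUpTo f zero    = refl
  sum-applyUpTo f (suc n) = begin
    + sum (List.map f (applyUpTo suc (suc n)))
      ≡⟨ cong (λ ks → + sum (List.map f ks)) (List.applyUpTo-∷ʳ suc n) ⟨
    + sum (List.map f (applyUpTo suc n ∷ʳ suc n))
      ≡⟨ cong (λ ks → + sum ks) (List.map-++ f (applyUpTo suc n) (suc n ∷ [])) ⟩
    + sum (List.map f (applyUpTo suc n) ++ f (suc n) ∷ [])
      ≡⟨ cong +_ (sum-++ (List.map f (applyUpTo suc n)) (f (suc n) ∷ [])) ⟩
    + (sum (List.map f (applyUpTo suc n)) ℕ.+ (f (suc n) ℕ.+ 0))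
      ≡⟨ cong (λ k → + (sum (List.map f (applyUpTo suc n)) ℕ.+ k)) (ℕ.+-identityʳ (f (suc n))) ⟩
    + sum (List.map f (applyUpTo suc n)) + + f (suc n)
      ≡⟨ cong (_+ + f (suc n)) (sum-applyUpTo f n) ⟩
    sumTo (suc n) (λ k → + f k) ∎

  -- Selecting divisors becomes weighting by 0 or 1; the absolute value brings the integer indicator
  -- back into ℕ.
  sum-filter-∣ : ∀ (f : ℕ → ℕ) m ks → sum (List.map f (filter (_∣? m) ks)) ≡
                 sum (List.map (λ k → f k ℕ.* ∣ indicator (k ∣? m) ∣) ks)
  sum-filter-∣ f m []       = refl
  sum-filter-∣ f m (k ∷ ks) with k ∣? m
  ... | yes _ = cong₂ ℕ._+_ (sym (ℕ.*-identityʳ (f k))) (sum-filter-∣ f m ks)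
  ... | no  _ = cong₂ ℕ._+_ (sym (ℕ.*-zeroʳ (f k))) (sum-filter-∣ f m ks)

  +∣indicator∣ : ∀ {P : Set} (p : Dec P) → + ∣ indicator p ∣ ≡ indicator p
  +∣indicator∣ (yes _) = refl
  +∣indicator∣ (no _)  = refl

  pos-^ : ∀ a k → + (a ℕ.^ k) ≡ (+ a) ^ k
  pos-^ a zero    = refl
  pos-^ a (suc k) = trans (ℤ.pos-* a (a ℕ.^ k)) (cong (+ a *_) (pos-^ a k))

  -- Indexed by the exponent of σ, not by the weight, and without constant term.
  E : ℕ → Series
  E k n = + σ k n

  -- The Lambert series of σ, cut off at any `N ≥ n` because `u a` starts at qᵃ. The freedom in `N`
  -- lets a single cut-off serve all coefficients that enter a product.
  E≡sumTo-u : ∀ k N n → n ≤ N → E k n ≡ sumTo N (λ a → (+ a) ^ k * u a n)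
  E≡sumTo-u k N zero    _   = sym (trans (sumTo-cong N (λ a → ℤ.*-zeroʳ ((+ suc a) ^ k))) (sumTo-0 N))
  E≡sumTo-u k N (suc n) n<N = begin
    + σ k (suc n)
      ≡⟨ cong +_ (sum-filter-∣ (ℕ._^ k) (suc n) (applyUpTo suc (suc n))) ⟩
    + sum (List.map (λ a → a ℕ.^ k ℕ.* ∣ indicator (a ∣? suc n) ∣) (applyUpTo suc (suc n)))
      ≡⟨ sum-applyUpTo (λ a → a ℕ.^ k ℕ.* ∣ indicator (a ∣? suc n) ∣) (suc n) ⟩
    sumTo (suc n) (λ a → + (a ℕ.^ k ℕ.* ∣ indicator (a ∣? suc n) ∣))
      ≡⟨ sumTo-cong (suc n) (λ a → trans (ℤ.pos-* (suc a ℕ.^ k) ∣ indicator (suc a ∣? suc n) ∣)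
           (cong₂ _*_ (pos-^ (suc a) k) (+∣indicator∣ (suc a ∣? suc n)))) ⟩
    sumTo (suc n) (λ a → (+ a) ^ k * u a (suc n))
      ≡⟨ sumTo-truncate (suc n) (N ∸ suc n) (λ a → (+ a) ^ k * u a (suc n))
           (λ a n<a → trans (cong ((+ a) ^ k *_) (u-< a (suc n) n<a)) (ℤ.*-zeroʳ ((+ a) ^ k))) ⟨
    sumTo (N ∸ suc n ℕ.+ suc n) (λ a → (+ a) ^ k * u a (suc n))
      ≡⟨ cong (λ M → sumTo M (λ a → (+ a) ^ k * u a (suc n))) (ℕ.m∸n+n≡m n<N) ⟩
    sumTo N (λ a → (+ a) ^ k * u a (suc n)) ∎

  sumTo-⊛ : ∀ N (x : ℕ → ℤ) (f : ℕ → Series) g n →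
    ((λ k → sumTo N (λ a → x a * f a k)) ⊛ g) n ≡ sumTo N (λ a → x a * (f a ⊛ g) n)
  sumTo-⊛ zero    x f g n = 0-⊛ g n
  sumTo-⊛ (suc N) x f g n = trans
    (⊛-distribʳ-⊕ g (λ k → sumTo N (λ a → x a * f a k)) (λ k → x (suc N) * f (suc N) k) n)
    (cong₂ _+_ (sumTo-⊛ N x f g n) (⊛-scaleˡ (x (suc N)) (f (suc N)) g n))

  module _ (n : ℕ) where
    open Moments n (+ n) (λ a b → (u a ⊛ u b) n) (λ a → u a n) (λ a b → u-⊛ a b n) (u-diagonal n)
      (u-⊛-<ʳ n) (u-⊛-<ˡ n) (λ a n<a → u-< a n n<a) public

  moment≡E : ∀ n k → moment n k ≡ E k n
  moment≡E n k = sym (E≡sumTo-u k n n ℕ.≤-refl)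

  moment²≡E⊛E : ∀ n i j → moment² n i j ≡ (E i ⊛ E j) n
  moment²≡E⊛E n i j = sym (begin
    (E i ⊛ E j) n
      ≡⟨ ⊛-cong-≤ {E i} {S i} {E j} {S j} n (λ k → E≡sumTo-u i n k) (λ k → E≡sumTo-u j n k) ⟩
    (S i ⊛ S j) n
      ≡⟨ sumTo-⊛ n (λ a → (+ a) ^ i) u (S j) n ⟩
    sumTo n (λ a → (+ a) ^ i * (u a ⊛ S j) n)
      ≡⟨ sumTo-cong n (λ a → row (suc a)) ⟩
    moment² n i j ∎)
    where
    S : ℕ → Series
    S k m = sumTo n (λ a → (+ a) ^ k * u a m)
    row : ∀ a → (+ a) ^ i * (u a ⊛ S j) n ≡ sumTo n (λ b → (+ a) ^ i * (+ b) ^ j * (u a ⊛ u b) n)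
    row a = begin
      (+ a) ^ i * (u a ⊛ S j) n
        ≡⟨ cong ((+ a) ^ i *_) (trans (⊛-comm (u a) (S j) n) (sumTo-⊛ n (λ b → (+ b) ^ j) u (u a) n)) ⟩
      (+ a) ^ i * sumTo n (λ b → (+ b) ^ j * (u b ⊛ u a) n)
        ≡⟨ sumTo-*ˡ n ((+ a) ^ i) (λ b → (+ b) ^ j * (u b ⊛ u a) n) ⟨
      sumTo n (λ b → (+ a) ^ i * ((+ b) ^ j * (u b ⊛ u a) n))
        ≡⟨ sumTo-cong n (λ b → trans
             (cong (λ t → (+ a) ^ i * ((+ suc b) ^ j * t)) (⊛-comm (u (suc b)) (u a) n))
             (sym (ℤ.*-assoc ((+ a) ^ i) ((+ suc b) ^ j) ((u a ⊛ u (suc b)) n)))) ⟩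
      sumTo n (λ b → (+ a) ^ i * (+ b) ^ j * (u a ⊛ u b) n) ∎

  combination-cong : ∀ n zs {f g : ℕ → ℤ} → f ≗ g → combination n zs f ≡ combination n zs g
  combination-cong n []                 f≗g = refl
  combination-cong n ((x , y , k) ∷ zs) f≗g =
    cong₂ (λ s t → (x + y * n) * s + t) (f≗g k) (combination-cong n zs f≗g)

  E-relation : ∀ n i j z zs → z * (moment² n i j + moment² n j i) ≡ combination (+ n) zs (moment n) →
               (const z ⊛ (E i ⊛ E j ⊕ E j ⊛ E i)) n ≡ combination (+ n) zs (λ k → E k n)
  E-relation n i j z zs relation = begin
    (const z ⊛ (E i ⊛ E j ⊕ E j ⊛ E i)) n       ≡⟨ const-⊛ z (E i ⊛ E j ⊕ E j ⊛ E i) n ⟩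
    z * ((E i ⊛ E j) n + (E j ⊛ E i) n)         ≡⟨ cong₂ (λ s t → z * (s + t)) (moment²≡E⊛E n i j) (moment²≡E⊛E n j i) ⟨
    z * (moment² n i j + moment² n j i)         ≡⟨ relation ⟩
    combination (+ n) zs (moment n)             ≡⟨ combination-cong (+ n) zs (moment≡E n) ⟩
    combination (+ n) zs (λ k → E k n)          ∎

  E₁⊛E₁ : const (+ 6) ⊛ (E 1 ⊛ E 1 ⊕ E 1 ⊛ E 1) ≗ const (+ 5) ⊛ E 3 ⊕ E 1 ⊕ ⊝ (const (+ 6) ⊛ D (E 1))
  E₁⊛E₁ n = trans (E-relation n 1 1 (+ 6)
    ((+ 5 , 0ℤ , 3) ∷ (+ 1 , - + 6 , 1) ∷ []) (moments₁₁ n)) (trans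
    (lemma (+ n) (E 1 n) (E 3 n))
    (sym (cong₂ (λ s t → s + E 1 n + - t) (const-⊛ (+ 5) (E 3) n) (const-⊛ (+ 6) (D (E 1)) n))))
    where
    lemma : ∀ n x z → (+ 5 + 0ℤ * n) * z + ((+ 1 + - + 6 * n) * x + 0ℤ) ≡ + 5 * z + x + - (+ 6 * (n * x))
    lemma = solve-∀

  E₁⊛E₃ : const (+ 120) ⊛ (E 1 ⊛ E 3 ⊕ E 3 ⊛ E 1) ≗
          const (+ 21) ⊛ E 5 ⊕ const (+ 10) ⊛ E 3 ⊕ ⊝ (const (+ 30) ⊛ D (E 3)) ⊕ ⊝ E 1
  E₁⊛E₃ n = trans (E-relation n 1 3 (+ 120)
    ((+ 21 , 0ℤ , 5) ∷ (+ 10 , - + 30 , 3) ∷ (- + 1 , 0ℤ , 1) ∷ []) (moments₁₃ n)) (trans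
    (lemma (+ n) (E 1 n) (E 3 n) (E 5 n))
    (sym (cong₂ (λ r t → r + - t + - E 1 n)
      (cong₂ _+_ (const-⊛ (+ 21) (E 5) n) (const-⊛ (+ 10) (E 3) n))
      (const-⊛ (+ 30) (D (E 3)) n))))
    where
    lemma : ∀ n x z w → (+ 21 + 0ℤ * n) * w + ((+ 10 + - + 30 * n) * z + ((- + 1 + 0ℤ * n) * x + 0ℤ)) ≡
            + 21 * w + + 10 * z + - (+ 30 * (n * z)) + - x
    lemma = solve-∀

  E₃⊛E₃ : const (+ 60) ⊛ (E 3 ⊛ E 3 ⊕ E 3 ⊛ E 3) ≗ E 7 ⊕ ⊝ E 3
  E₃⊛E₃ n = trans (E-relation n 3 3 (+ 60)
    ((+ 1 , 0ℤ , 7) ∷ (- + 1 , 0ℤ , 3) ∷ []) (moments₃₃ n)) (lemma (+ n) (E 3 n) (E 7 n))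
    where
    lemma : ∀ n z t → (+ 1 + 0ℤ * n) * t + ((- + 1 + 0ℤ * n) * z + 0ℤ) ≡ t + - z
    lemma = solve-∀

  E₁⊛E₅ : const (+ 504) ⊛ (E 1 ⊛ E 5 ⊕ E 5 ⊛ E 1) ≗
          const (+ 40) ⊛ E 7 ⊕ const (+ 42) ⊛ E 5 ⊕ ⊝ (const (+ 84) ⊛ D (E 5)) ⊕ const (+ 2) ⊛ E 1
  E₁⊛E₅ n = trans (E-relation n 1 5 (+ 504)
    ((+ 40 , 0ℤ , 7) ∷ (+ 42 , - + 84 , 5) ∷ (+ 2 , 0ℤ , 1) ∷ []) (moments₁₅ n)) (trans
    (lemma (+ n) (E 1 n) (E 5 n) (E 7 n))
    (sym (cong₂ _+_
      (cong₂ (λ r t → r + - t)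
        (cong₂ _+_ (const-⊛ (+ 40) (E 7) n) (const-⊛ (+ 42) (E 5) n))
        (const-⊛ (+ 84) (D (E 5)) n))
      (const-⊛ (+ 2) (E 1) n))))
    where
    lemma : ∀ n x w t → (+ 40 + 0ℤ * n) * t + ((+ 42 + - + 84 * n) * w + ((+ 2 + 0ℤ * n) * x + 0ℤ)) ≡
            + 40 * t + + 42 * w + - (+ 84 * (n * w)) + + 2 * x
    lemma = solve-∀

  open Ramanujan (E 1) (E 3) (E 5) (E 7) E₁⊛E₁ E₁⊛E₃ E₃⊛E₃ E₁⊛E₅ public

  -- The logarithmic derivative -m qᵐ / (1 - qᵐ) of 1 - qᵐ.
  dlog : ℕ → Series
  dlog m = ⊝ (const (+ m) ⊛ u m)

  D-1-q^ : ∀ m → .{{_ : NonZero m}} → D (𝟙 ⊖ q ^ˢ m) ≗ dlog m ⊛ (𝟙 ⊖ q ^ˢ m)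
  D-1-q^ (suc m) = ≗.trans (D-cong {𝟙 ⊖ X} 1-X) (≗.trans
    (D-1-X {const (+ suc m)} {X} {u (suc m)} (D-q^ (suc m)) (u-fixpoint m))
    (≗.sym (⊛-congʳ (dlog (suc m)) (𝟙 ⊖ X) (const 1ℤ ⊕ ⊝ X) 1-X)))
    where
    X = q ^ˢ suc m
    1-X : 𝟙 ⊖ X ≗ const 1ℤ ⊕ ⊝ X
    1-X n = cong (_- X n) (𝟙≗const-1 n)

  module _ (F : ℕ → Series) (k : ℤ) (D-F : ∀ m → .{{_ : NonZero m}} → D (F m) ≗ (const k ⊛ dlog m) ⊛ F m)
    (F≡𝟙 : ∀ m → F m ≡ 𝟙 mod-q^ m)
    where

    dlog-∏ : ℕ → Series
    dlog-∏ zero    = const 0ℤ ⊛ 𝟙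
    dlog-∏ (suc N) = const k ⊛ dlog (suc N) ⊕ dlog-∏ N

    D-∏ : ∀ N → D (∏ N F) ≗ dlog-∏ N ⊛ ∏ N F
    D-∏ zero    = logarithmic-1 𝟙
    D-∏ (suc N) = logarithmic-* {F (suc N)} {∏ N F} {const k ⊛ dlog (suc N)} {dlog-∏ N} (D-F (suc N)) (D-∏ N)

    dlog-∏-coefficient : ∀ N j → dlog-∏ N j ≡ - k * sumTo N (λ a → (+ a) ^ 1 * u a j)
    dlog-∏-coefficient zero    j = begin
      (const 0ℤ ⊛ 𝟙) j   ≡⟨ const-⊛ 0ℤ 𝟙 j ⟩
      0ℤ * 𝟙 j           ≡⟨ ℤ.*-zeroˡ (𝟙 j) ⟩
      0ℤ                 ≡⟨ ℤ.*-zeroʳ (- k) ⟨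
      - k * 0ℤ           ∎
    dlog-∏-coefficient (suc N) j = begin
      (const k ⊛ dlog (suc N)) j + dlog-∏ N j
        ≡⟨ cong₂ _+_ (trans (const-⊛ k (dlog (suc N)) j) (cong (λ t → k * - t) (const-⊛ A (u (suc N)) j)))
             (dlog-∏-coefficient N j) ⟩
      k * - (A * u (suc N) j) + - k * s
        ≡⟨ lemma k A (u (suc N) j) s ⟩
      - k * (s + A ^ 1 * u (suc N) j) ∎
      where
      A = + suc N
      s = sumTo N (λ a → (+ a) ^ 1 * u a j)
      lemma : ∀ k a x s → k * - (a * x) + - k * s ≡ - k * (s + a * 1ℤ * x)
      lemma = solve-∀

    -- No infinite sum of logarithmic derivatives is formed: up to qⁿ the product agrees with its
    -- first n factors, and their logarithmic derivatives add up to the cut-off Lambert series of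
    -- σ₁. For k = 24 this is -24 `E 1`, and the factor q of τ adds the 1 of P.
    D-∏∞ : D (∏∞ F) ≗ (const (- k) ⊛ E 1) ⊛ ∏∞ F
    D-∏∞ n = trans (D-∏ n n) (⊛-cong-≤ {dlog-∏ n} {const (- k) ⊛ E 1} {∏ n F} {∏∞ F} n
      (λ j j≤n → trans (dlog-∏-coefficient n j) (trans
        (cong (- k *_) (sym (E≡sumTo-u 1 n j j≤n)))
        (sym (const-⊛ (- k) (E 1) j))))
      (λ j j≤n → proj₂ (∏-converges F F≡𝟙 j) n j≤n))

    D-q-⊛-∏∞ : D (q ⊛ ∏∞ F) ≗ (const 1ℤ ⊕ const (- k) ⊛ E 1) ⊛ (q ⊛ ∏∞ F)
    D-q-⊛-∏∞ = ≗.trans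
      (logarithmic-* {q} {∏∞ F} {𝟙} {const (- k) ⊛ E 1} D-q D-∏∞)
      (⊛-congˡ (𝟙 ⊕ const (- k) ⊛ E 1) (const 1ℤ ⊕ const (- k) ⊛ E 1) (q ⊛ ∏∞ F)
        (λ j → cong (_+ (const (- k) ⊛ E 1) j) (𝟙≗const-1 j)))

  D-[1-q^]^ : ∀ k m → .{{_ : NonZero m}} → D ((𝟙 ⊖ q ^ˢ m) ^ˢ k) ≗ (const (+ k) ⊛ dlog m) ⊛ (𝟙 ⊖ q ^ˢ m) ^ˢ k
  D-[1-q^]^ k m = D-^ˢ {𝟙 ⊖ q ^ˢ m} {dlog m} (D-1-q^ m) k

  D-τ : D τ ≗ P ⊛ τ
  D-τ = D-q-⊛-∏∞ [1-q^_]²⁴ (+ 24) (D-[1-q^]^ 24) [1-q^m]²⁴≡𝟙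

  -- At qᵏ the equation reads (k - g 0) f k = ∑ g (k - j) f j over j < k. As g 0 = 1, the factor k -
  -- 1 vanishes only for k = 1, where f 1 = 0 is assumed. The bound `n` carries the course-of-values
  -- induction.
  D-unique : ∀ g f → g 0 ≡ 1ℤ → D f ≗ g ⊛ f → f 1 ≡ 0ℤ → ∀ n k → k ≤ n → f k ≡ 0ℤ
  D-unique g f g₀ Df f₁ n zero k≤n = begin
    f 0              ≡⟨ ℤ.*-identityˡ (f 0) ⟨
    1ℤ * f 0         ≡⟨ cong (_* f 0) g₀ ⟨
    g 0 * f 0        ≡⟨ ℤ.+-identityʳ (g 0 * f 0) ⟨
    (g ⊛ f) 0        ≡⟨ Df 0 ⟨
    0ℤ * f 0         ≡⟨ ℤ.*-zeroˡ (f 0) ⟩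
    0ℤ               ∎
  D-unique g f g₀ Df f₁ n       (suc zero)    k≤n     = f₁
  D-unique g f g₀ Df f₁ (suc n) (suc (suc k)) (s≤s k<n) = ℤ.*-cancelˡ-≡ (+ suc k) (f m) 0ℤ (begin
    + suc k * f m              ≡⟨ lemma (+ suc k) (f m) ⟩
    + m * f m - f m            ≡⟨ cong (_- f m) (Df m) ⟩
    (g ⊛ f) m - f m            ≡⟨⟩
    g 0 * f m + (g ∘ suc ⊛ f) (suc k) - f m
      ≡⟨ cong₂ (λ x y → x * f m + y - f m) g₀ tail≡0 ⟩
    1ℤ * f m + 0ℤ - f m        ≡⟨ lemma₂ (+ suc k) (f m) ⟩
    + suc k * 0ℤ               ∎)
    where
    m = suc (suc k)
    tail≡0 : (g ∘ suc ⊛ f) (suc k) ≡ 0ℤ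
    tail≡0 = trans
      (⊛-cong-≤ {g ∘ suc} {g ∘ suc} {f} {λ _ → 0ℤ} (suc k) (λ _ _ → refl)
        (λ j j≤1+k → D-unique g f g₀ Df f₁ n j (ℕ.≤-trans j≤1+k k<n)))
      (trans (⊛-comm (g ∘ suc) (λ _ → 0ℤ) (suc k)) (0-⊛ (g ∘ suc) (suc k)))
    lemma : ∀ k x → k * x ≡ (1ℤ + k) * x - x
    lemma = solve-∀
    lemma₂ : ∀ k x → 1ℤ * x + 0ℤ - x ≡ k * 0ℤ
    lemma₂ = solve-∀

  1728τ≗Δ : const (+ 1728) ⊛ τ ≗ Δ
  1728τ≗Δ n = ℤ.i-j≡0⇒i≡j _ _ (D-unique P f refl Df f₁ n n ℕ.≤-refl)
    where
    f = const (+ 1728) ⊛ τ ⊕ ⊝ Δ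
    Df : D f ≗ P ⊛ f
    Df = eigen-minus {P} {const (+ 1728) ⊛ τ} {Δ} (eigen-ι* {P} {τ} (+ 1728) D-τ) DΔ
    -- The factor 1728 is fixed here: τ 1 = 1, and the first coefficient of Q³ - R² evaluates to 3 ·
    -- 240 + 2 · 504 = 1728.
    f₁ : f 1 ≡ 0ℤ
    f₁ = cong (_- Δ 1) (trans (const-⊛ (+ 1728) τ 1) (cong (+ 1728 *_) (q-⊛-suc (∏∞ [1-q^_]²⁴) 0)))

  const-cancelˡ : ∀ z → .{{_ : ℤ.NonZero z}} → ∀ f g → const z ⊛ f ≗ const z ⊛ g → f ≗ g
  const-cancelˡ z f g zf≗zg n = ℤ.*-cancelˡ-≡ z (f n) (g n) (begin
    z * f n           ≡⟨ const-⊛ z f n ⟨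
    (const z ⊛ f) n   ≡⟨ zf≗zg n ⟩
    (const z ⊛ g) n   ≡⟨ const-⊛ z g n ⟩
    z * g n           ∎)

  τ≗Γ : τ ≗ Γ
  τ≗Γ = const-cancelˡ (+ 34560) τ Γ (cusp-form {τ} 1728τ≗Δ)

  τ-coefficient : ∀ n → τ n ≡ + n * (+ n * E 7 n) - + 540 * (D (E 3) ⊛ D (E 3)) n
  τ-coefficient n = trans (τ≗Γ n) (cong (_-_ (+ n * (+ n * E 7 n))) (const-⊛ (+ 540) (D (E 3) ⊛ D (E 3)) n))

-- Convolution sums over 1 ≤ m < n, and the four identities over ℤ.

module Identities where

  open import Data.Integer.Base using (ℤ; +_; 0ℤ; 1ℤ; _+_; _-_; -_; _*_)
  open PowerSeries
  open Summation
  open Eisenstein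
  open ≡-Reasoning

  ⊛-sumTo : ∀ f g n → (f ⊛ g) n ≡ f 0 * g n + sumTo n (λ m → f m * g (n ∸ m))
  ⊛-sumTo f g zero    = refl
  ⊛-sumTo f g (suc n) = begin
    f 0 * g (suc n) + (f ∘ suc ⊛ g) n
      ≡⟨ cong (_+_ (f 0 * g (suc n))) (⊛-sumTo (f ∘ suc) g n) ⟩
    f 0 * g (suc n) + (f 1 * g n + sumTo n (λ m → f (suc m) * g (n ∸ m)))
      ≡⟨ cong (λ t → f 0 * g (suc n) + (t + sumTo n (λ m → f (suc m) * g (n ∸ m)))) (ℤ.+-identityˡ (f 1 * g n)) ⟨
    f 0 * g (suc n) + (0ℤ + f 1 * g n + sumTo n (λ m → f (suc m) * g (n ∸ m)))
      ≡⟨ cong (_+_ (f 0 * g (suc n))) (sumTo-split 1 n (λ m → f m * g (suc n ∸ m))) ⟨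
    f 0 * g (suc n) + sumTo (suc n) (λ m → f m * g (suc n ∸ m)) ∎

  -- Vanishing constant terms remove the two ends m = 0 and m = n of the convolution.
  ⊛-∑₁ : ∀ f g (F : ℕ → ℕ) n → .{{_ : NonZero n}} → f 0 ≡ 0ℤ → g 0 ≡ 0ℤ → (∀ m → f m * g (n ∸ m) ≡ + F m) →
         (f ⊛ g) n ≡ + ∑₁ n F
  ⊛-∑₁ f g F (suc n) f₀ g₀ fg≡F = begin
    (f ⊛ g) (suc n)
      ≡⟨ ⊛-sumTo f g (suc n) ⟩
    f 0 * g (suc n) + (sumTo n (λ m → f m * g (suc n ∸ m)) + f (suc n) * g (n ∸ n))
      ≡⟨ cong₂ (λ x k → x * g (suc n) + (sumTo n (λ m → f m * g (suc n ∸ m)) + f (suc n) * g k)) f₀ (ℕ.n∸n≡0 n) ⟩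
    0ℤ * g (suc n) + (sumTo n (λ m → f m * g (suc n ∸ m)) + f (suc n) * g 0)
      ≡⟨ cong₂ (λ s y → 0ℤ * g (suc n) + (s + f (suc n) * y)) (sumTo-cong n (λ m → fg≡F (suc m))) g₀ ⟩
    0ℤ * g (suc n) + (sumTo n (λ m → + F m) + f (suc n) * 0ℤ)
      ≡⟨ lemma (g (suc n)) (sumTo n (λ m → + F m)) (f (suc n)) ⟩
    sumTo n (λ m → + F m)
      ≡⟨ sum-applyUpTo F n ⟨
    + ∑₁ (suc n) F ∎
    where
    lemma : ∀ x s y → 0ℤ * x + (s + y * 0ℤ) ≡ s
    lemma = solve-∀

  module Convolutions (n : ℕ) .{{n≢0 : NonZero n}} where

    -- The sums of (i), (ii), (iii) and (iv). A factor m or n - m in the summand is a `D` on the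
    -- first or second `E 3`.
    A B C G : ℕ
    A = ∑₁ n (λ m → m ℕ.* (n ∸ m) ℕ.* σ 3 m ℕ.* σ 3 (n ∸ m))
    B = ∑₁ n (λ m → m ℕ.^ 2 ℕ.* σ 3 m ℕ.* σ 3 (n ∸ m))
    C = ∑₁ n (λ m → m ℕ.^ 2 ℕ.* (n ∸ m) ℕ.* σ 3 m ℕ.* σ 3 (n ∸ m))
    G = ∑₁ n (λ m → m ℕ.^ 3 ℕ.* σ 3 m ℕ.* σ 3 (n ∸ m))

    pos-*₃ : ∀ a b c → + (a ℕ.* b ℕ.* c) ≡ + a * + b * + c
    pos-*₃ a b c = trans (ℤ.pos-* (a ℕ.* b) c) (cong (_* + c) (ℤ.pos-* a b))

    pos-*₄ : ∀ a b c d → + (a ℕ.* b ℕ.* c ℕ.* d) ≡ + a * + b * + c * + d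
    pos-*₄ a b c d = trans (ℤ.pos-* (a ℕ.* b ℕ.* c) d) (cong (_* + d) (pos-*₃ a b c))

    A-⊛ : (D (E 3) ⊛ D (E 3)) n ≡ + A
    A-⊛ = ⊛-∑₁ (D (E 3)) (D (E 3)) _ n refl refl λ m →
      trans (lemma (+ m) (+ (n ∸ m)) (E 3 m) (E 3 (n ∸ m))) (sym (pos-*₄ m (n ∸ m) (σ 3 m) (σ 3 (n ∸ m))))
      where
      lemma : ∀ m k x y → (m * x) * (k * y) ≡ m * k * x * y
      lemma = solve-∀

    B-⊛ : (D (D (E 3)) ⊛ E 3) n ≡ + B
    B-⊛ = ⊛-∑₁ (D (D (E 3))) (E 3) _ n refl refl λ m →
      trans (lemma (+ m) (E 3 m) (E 3 (n ∸ m)))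
        (sym (trans (pos-*₃ (m ℕ.^ 2) (σ 3 m) (σ 3 (n ∸ m))) (cong (λ t → t * E 3 m * E 3 (n ∸ m)) (pos-^ m 2))))
      where
      lemma : ∀ m x y → (m * (m * x)) * y ≡ (m * (m * 1ℤ)) * x * y
      lemma = solve-∀

    C-⊛ : (D (D (E 3)) ⊛ D (E 3)) n ≡ + C
    C-⊛ = ⊛-∑₁ (D (D (E 3))) (D (E 3)) _ n refl refl λ m →
      trans (lemma (+ m) (+ (n ∸ m)) (E 3 m) (E 3 (n ∸ m)))
        (sym (trans (pos-*₄ (m ℕ.^ 2) (n ∸ m) (σ 3 m) (σ 3 (n ∸ m)))
          (cong (λ t → t * + (n ∸ m) * E 3 m * E 3 (n ∸ m)) (pos-^ m 2))))
      where
      lemma : ∀ m k x y → (m * (m * x)) * (k * y) ≡ (m * (m * 1ℤ)) * k * x * y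
      lemma = solve-∀

    G-⊛ : (D (D (D (E 3))) ⊛ E 3) n ≡ + G
    G-⊛ = ⊛-∑₁ (D (D (D (E 3)))) (E 3) _ n refl refl λ m →
      trans (lemma (+ m) (E 3 m) (E 3 (n ∸ m)))
        (sym (trans (pos-*₃ (m ℕ.^ 3) (σ 3 m) (σ 3 (n ∸ m))) (cong (λ t → t * E 3 m * E 3 (n ∸ m)) (pos-^ m 3))))
      where
      lemma : ∀ m x y → (m * (m * (m * x))) * y ≡ (m * (m * (m * 1ℤ))) * x * y
      lemma = solve-∀

    X Y : ℕ
    X = n ℕ.^ 2 ℕ.* σ 7 n
    Y = n ℕ.^ 2 ℕ.* σ 3 n

    pos-n²* : ∀ s → + (n ℕ.^ 2 ℕ.* s) ≡ + n * (+ n * + s)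
    pos-n²* s = trans (ℤ.pos-* (n ℕ.^ 2) s) (trans (cong (_* + s) (pos-^ n 2)) (lemma (+ n) (+ s)))
      where
      lemma : ∀ n s → (n * (n * 1ℤ)) * s ≡ n * (n * s)
      lemma = solve-∀

    identity-i : τ n ≡ + X - + 540 * + A
    identity-i = trans (τ-coefficient n) (cong₂ (λ x a → x - + 540 * a) (sym (pos-n²* (σ 7 n))) A-⊛)

    A+B : + 120 * (+ A + + B + (+ A + + B)) ≡ + X - + Y
    A+B = begin
      + 120 * (+ A + + B + (+ A + + B))
        ≡⟨ cong₂ (λ a b → + 120 * (a + b + (a + b))) A-⊛ B-⊛ ⟨
      + 120 * (DE₃² ⊕ DDE₃E₃ ⊕ (DE₃² ⊕ DDE₃E₃)) n
        ≡⟨ const-⊛ (+ 120) (DE₃² ⊕ DDE₃E₃ ⊕ (DE₃² ⊕ DDE₃E₃)) n ⟨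
      (const (+ 120) ⊛ (DE₃² ⊕ DDE₃E₃ ⊕ (DE₃² ⊕ DDE₃E₃))) n
        ≡⟨ DDE₃² n ⟩
      + n * (+ n * E 7 n) - + n * (+ n * E 3 n)
        ≡⟨ cong₂ _-_ (pos-n²* (σ 7 n)) (pos-n²* (σ 3 n)) ⟨
      + X - + Y ∎
      where
      DE₃² = D (E 3) ⊛ D (E 3)
      DDE₃E₃ = D (D (E 3)) ⊛ E 3

    -- Leibniz, that is n = m + (n - m): the two halves are exchanged by m ↦ n - m. In `nB≡G+C` they
    -- differ, and the second is again C.
    nA≡2C : + n * + A ≡ + C + + C
    nA≡2C = begin
      + n * + A                        ≡⟨ cong (+ n *_) A-⊛ ⟨
      + n * (D (E 3) ⊛ D (E 3)) n      ≡⟨ D-⊛ (D (E 3)) (D (E 3)) n ⟩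
      (D (D (E 3)) ⊛ D (E 3)) n + (D (E 3) ⊛ D (D (E 3))) n
        ≡⟨ cong (_+_ ((D (D (E 3)) ⊛ D (E 3)) n)) (⊛-comm (D (E 3)) (D (D (E 3))) n) ⟩
      (D (D (E 3)) ⊛ D (E 3)) n + (D (D (E 3)) ⊛ D (E 3)) n ≡⟨ cong₂ _+_ C-⊛ C-⊛ ⟩
      + C + + C                        ∎

    nB≡G+C : + n * + B ≡ + G + + C
    nB≡G+C = begin
      + n * + B                        ≡⟨ cong (+ n *_) B-⊛ ⟨
      + n * (D (D (E 3)) ⊛ E 3) n      ≡⟨ D-⊛ (D (D (E 3))) (E 3) n ⟩
      (D (D (D (E 3))) ⊛ E 3) n + (D (D (E 3)) ⊛ D (E 3)) n ≡⟨ cong₂ _+_ G-⊛ C-⊛ ⟩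
      + G + + C                        ∎

    -- Since 4 · 540 = 9 · 240, adding nine times `A+B` to four times (i) replaces A by B.
    identity-ii : + 4 * τ n ≡ - + 5 * + X + + 9 * + Y + + 2160 * + B
    identity-ii = begin
      + 4 * τ n                                      ≡⟨ cong (+ 4 *_) identity-i ⟩
      + 4 * (+ X - + 540 * + A)                      ≡⟨ lemma (+ X) (+ A) (+ B) ⟩
      + 4 * + X + + 2160 * + B - + 9 * (+ 120 * (+ A + + B + (+ A + + B)))
                                                     ≡⟨ cong (λ t → + 4 * + X + + 2160 * + B - + 9 * t) A+B ⟩
      + 4 * + X + + 2160 * + B - + 9 * (+ X - + Y)   ≡⟨ lemma₂ (+ X) (+ Y) (+ B) ⟩
      - + 5 * + X + + 9 * + Y + + 2160 * + B         ∎
      where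
      lemma : ∀ x a b → + 4 * (x - + 540 * a) ≡ + 4 * x + + 2160 * b - + 9 * (+ 120 * (a + b + (a + b)))
      lemma = solve-∀
      lemma₂ : ∀ x y b → + 4 * x + + 2160 * b - + 9 * (x - y) ≡ - + 5 * x + + 9 * y + + 2160 * b
      lemma₂ = solve-∀

    identity-iii : + n * τ n ≡ + n * + X - + 1080 * + C
    identity-iii = begin
      + n * τ n                          ≡⟨ cong (+ n *_) identity-i ⟩
      + n * (+ X - + 540 * + A)          ≡⟨ lemma (+ n) (+ X) (+ A) ⟩
      + n * + X - + 540 * (+ n * + A)    ≡⟨ cong (λ t → + n * + X - + 540 * t) nA≡2C ⟩
      + n * + X - + 540 * (+ C + + C)    ≡⟨ lemma₂ (+ n * + X) (+ C) ⟩
      + n * + X - + 1080 * + C           ∎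
      where
      lemma : ∀ n x a → n * (x - + 540 * a) ≡ n * x - + 540 * (n * a)
      lemma = solve-∀
      lemma₂ : ∀ x c → x - + 540 * (c + c) ≡ x - + 1080 * c
      lemma₂ = solve-∀

    -- 6 n = 4 n + 2 n: n times (ii) plus twice (iii) leaves 2160 (n B - C), which is 2160 G.
    identity-iv : + 6 * + n * τ n ≡ - + 3 * + n * + X + + 9 * + n * + Y + + 2160 * + G
    identity-iv = begin
      + 6 * + n * τ n
        ≡⟨ lemma (+ n) (τ n) ⟩
      + n * (+ 4 * τ n) + + 2 * (+ n * τ n)
        ≡⟨ cong₂ (λ s t → + n * s + + 2 * t) identity-ii identity-iii ⟩
      + n * (- + 5 * + X + + 9 * + Y + + 2160 * + B) + + 2 * (+ n * + X - + 1080 * + C)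
        ≡⟨ lemma₂ (+ n) (+ X) (+ Y) (+ B) (+ C) ⟩
      - + 3 * + n * + X + + 9 * + n * + Y + + 2160 * (+ n * + B) - + 2160 * + C
        ≡⟨ cong (λ t → - + 3 * + n * + X + + 9 * + n * + Y + + 2160 * t - + 2160 * + C) nB≡G+C ⟩
      - + 3 * + n * + X + + 9 * + n * + Y + + 2160 * (+ G + + C) - + 2160 * + C
        ≡⟨ lemma₃ (- + 3 * + n * + X + + 9 * + n * + Y) (+ G) (+ C) ⟩
      - + 3 * + n * + X + + 9 * + n * + Y + + 2160 * + G ∎
      where
      lemma : ∀ n t → + 6 * n * t ≡ n * (+ 4 * t) + + 2 * (n * t)
      lemma = solve-∀
      lemma₂ : ∀ n x y b c → n * (- + 5 * x + + 9 * y + + 2160 * b) + + 2 * (n * x - + 1080 * c) ≡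
               - + 3 * n * x + + 9 * n * y + + 2160 * (n * b) - + 2160 * c
      lemma₂ = solve-∀
      lemma₃ : ∀ s g c → s + + 2160 * (g + c) - + 2160 * c ≡ s + + 2160 * g
      lemma₃ = solve-∀

-- From integer identities to rational coefficients.

module Denominators where

  open import Data.Integer.Base using (ℤ; +_; 0ℤ; 1ℤ; _+_; _-_; -_; _*_)
  open ≡-Reasoning
  open ℚSolver using (solve; _:=_; _:+_; _:*_; _:-_)

  -- Operations in ℚ reduce by a gcd, whereas equality of unnormalised rationals is cross
  -- multiplication in ℤ; the laws for `fromℤ` and `/` are therefore checked there.
  toℚᵘ-/ : ∀ z n → .{{_ : NonZero n}} → ℚ.toℚᵘ (z / n) ℚᵘ.≃ z ℚᵘ./ n
  toℚᵘ-/ z (suc n) = ℚ.toℚᵘ-fromℚᵘ (ℚᵘ.mkℚᵘ z n)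

  fromℤ-+ : ∀ x y → fromℤ (x + y) ≡ fromℤ x ℚ.+ fromℤ y
  fromℤ-+ x y = ℚ.toℚᵘ-injective (≃.begin
    ℚ.toℚᵘ (fromℤ (x + y))                ≃.≈⟨ toℚᵘ-/ (x + y) 1 ⟩
    (x + y) ℚᵘ./ 1                        ≃.≈⟨ ℚᵘ.*≡* (lemma x y) ⟩
    x ℚᵘ./ 1 ℚᵘ.+ y ℚᵘ./ 1                ≃.≈⟨ ℚᵘ.+-cong (toℚᵘ-/ x 1) (toℚᵘ-/ y 1) ⟨
    ℚ.toℚᵘ (fromℤ x) ℚᵘ.+ ℚ.toℚᵘ (fromℤ y) ≃.≈⟨ ℚ.toℚᵘ-homo-+ (fromℤ x) (fromℤ y) ⟨
    ℚ.toℚᵘ (fromℤ x ℚ.+ fromℤ y)          ≃.∎)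
    where
    module ≃ = ≈-Reasoning ℚᵘ.≃-setoid
    lemma : ∀ x y → (x + y) * 1ℤ ≡ (x * 1ℤ + y * 1ℤ) * 1ℤ
    lemma = solve-∀

  fromℤ-neg : ∀ x → fromℤ (- x) ≡ ℚ.- fromℤ x
  fromℤ-neg x = ℚ.toℚᵘ-injective (≃.begin
    ℚ.toℚᵘ (fromℤ (- x))                  ≃.≈⟨ toℚᵘ-/ (- x) 1 ⟩
    ℚᵘ.- (x ℚᵘ./ 1)                       ≃.≈⟨ ℚᵘ.-‿cong (toℚᵘ-/ x 1) ⟨
    ℚᵘ.- ℚ.toℚᵘ (fromℤ x)                 ≃.≈⟨ ℚ.toℚᵘ-homo‿- (fromℤ x) ⟨
    ℚ.toℚᵘ (ℚ.- fromℤ x)                  ≃.∎)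
    where
    module ≃ = ≈-Reasoning ℚᵘ.≃-setoid

  fromℤ-* : ∀ x y → fromℤ (x * y) ≡ fromℤ x ℚ.* fromℤ y
  fromℤ-* x y = ℚ.toℚᵘ-injective (≃.begin
    ℚ.toℚᵘ (fromℤ (x * y))                ≃.≈⟨ toℚᵘ-/ (x * y) 1 ⟩
    (x * y) ℚᵘ./ 1                        ≃.≈⟨ ℚᵘ.*≡* refl ⟩
    (x ℚᵘ./ 1) ℚᵘ.* (y ℚᵘ./ 1)               ≃.≈⟨ ℚᵘ.*-cong (toℚᵘ-/ x 1) (toℚᵘ-/ y 1) ⟨
    ℚ.toℚᵘ (fromℤ x) ℚᵘ.* ℚ.toℚᵘ (fromℤ y) ≃.≈⟨ ℚ.toℚᵘ-homo-* (fromℤ x) (fromℤ y) ⟨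
    ℚ.toℚᵘ (fromℤ x ℚ.* fromℤ y)          ≃.∎)
    where
    module ≃ = ≈-Reasoning ℚᵘ.≃-setoid

  /-*-fromℕ : ∀ z n → .{{_ : NonZero n}} → z / n ℚ.* fromℕ n ≡ fromℤ z
  /-*-fromℕ z (suc n) = ℚ.toℚᵘ-injective (≃.begin
    ℚ.toℚᵘ (z / suc n ℚ.* fromℕ (suc n))  ≃.≈⟨ ℚ.toℚᵘ-homo-* (z / suc n) (fromℕ (suc n)) ⟩
    ℚ.toℚᵘ (z / suc n) ℚᵘ.* ℚ.toℚᵘ (fromℕ (suc n)) ≃.≈⟨ ℚᵘ.*-cong (toℚᵘ-/ z (suc n)) (toℚᵘ-/ (+ suc n) 1) ⟩
    z ℚᵘ./ suc n ℚᵘ.* (+ suc n ℚᵘ./ 1)    ≃.≈⟨ ℚᵘ.*≡* (trans (lemma z (+ suc n))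
                                              (cong (λ k → z * + suc k) (sym (ℕ.*-identityʳ n)))) ⟩
    z ℚᵘ./ 1                              ≃.≈⟨ toℚᵘ-/ z 1 ⟨
    ℚ.toℚᵘ (fromℤ z)                      ≃.∎)
    where
    module ≃ = ≈-Reasoning ℚᵘ.≃-setoid
    lemma : ∀ z n → z * n * 1ℤ ≡ z * n
    lemma = solve-∀

  fromℕ-cancelˡ : ∀ n → .{{_ : NonZero n}} → ∀ {p r} → fromℕ n ℚ.* p ≡ fromℕ n ℚ.* r → p ≡ r
  fromℕ-cancelˡ n {p} {r} np≡nr = begin
    p                                   ≡⟨ unit p ⟨
    + 1 / n ℚ.* (fromℕ n ℚ.* p)         ≡⟨ cong (+ 1 / n ℚ.*_) np≡nr ⟩
    + 1 / n ℚ.* (fromℕ n ℚ.* r)         ≡⟨ unit r ⟩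
    r                                   ∎
    where
    unit : ∀ s → + 1 / n ℚ.* (fromℕ n ℚ.* s) ≡ s
    unit s = begin
      + 1 / n ℚ.* (fromℕ n ℚ.* s)  ≡⟨ ℚ.*-assoc (+ 1 / n) (fromℕ n) s ⟨
      + 1 / n ℚ.* fromℕ n ℚ.* s    ≡⟨ cong (ℚ._* s) (/-*-fromℕ (+ 1) n) ⟩
      ℚ.1ℚ ℚ.* s                   ≡⟨ ℚ.*-identityˡ s ⟩
      s                            ∎

  -- The coefficient is specified by α · d = z rather than as a quotient, so that one statement
  -- covers the integer 540 with d = 1 and the fraction 1080 / n with d = n.
  divide₂ : ∀ d → .{{_ : NonZero d}} → ∀ α t x z b → α ℚ.* fromℕ d ≡ fromℤ z →
            + d * t ≡ + d * x - z * b → fromℤ t ≡ fromℤ x ℚ.- α ℚ.* fromℤ b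
  divide₂ d α t x z b αd≡z dt≡ = fromℕ-cancelˡ d (begin
    fromℕ d ℚ.* fromℤ t                   ≡⟨ fromℤ-* (+ d) t ⟨
    fromℤ (+ d * t)                       ≡⟨ cong fromℤ dt≡ ⟩
    fromℤ (+ d * x - z * b)               ≡⟨ fromℤ-+ (+ d * x) (- (z * b)) ⟩
    fromℤ (+ d * x) ℚ.+ fromℤ (- (z * b))
      ≡⟨ cong₂ ℚ._+_ (fromℤ-* (+ d) x) (trans (fromℤ-neg (z * b)) (cong ℚ.-_ (fromℤ-* z b))) ⟩
    fromℕ d ℚ.* fromℤ x ℚ.- fromℤ z ℚ.* fromℤ b
      ≡⟨ cong (λ s → fromℕ d ℚ.* fromℤ x ℚ.- s ℚ.* fromℤ b) αd≡z ⟨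
    fromℕ d ℚ.* fromℤ x ℚ.- α ℚ.* fromℕ d ℚ.* fromℤ b
      ≡⟨ solve 4 (λ α d x b → d :* x :- α :* d :* b := d :* (x :- α :* b)) refl α (fromℕ d) (fromℤ x) (fromℤ b) ⟩
    fromℕ d ℚ.* (fromℤ x ℚ.- α ℚ.* fromℤ b) ∎)

  divide₃ : ∀ d → .{{_ : NonZero d}} → ∀ α β γ t u x v y w b →
            α ℚ.* fromℕ d ≡ fromℤ u → β ℚ.* fromℕ d ≡ fromℤ v → γ ℚ.* fromℕ d ≡ fromℤ w →
            + d * t ≡ u * x + v * y + w * b →
            fromℤ t ≡ α ℚ.* fromℤ x ℚ.+ β ℚ.* fromℤ y ℚ.+ γ ℚ.* fromℤ b
  divide₃ d α β γ t u x v y w b αd≡u βd≡v γd≡w dt≡ = fromℕ-cancelˡ d (begin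
    fromℕ d ℚ.* fromℤ t                       ≡⟨ fromℤ-* (+ d) t ⟨
    fromℤ (+ d * t)                           ≡⟨ cong fromℤ dt≡ ⟩
    fromℤ (u * x + v * y + w * b)
      ≡⟨ trans (fromℤ-+ (u * x + v * y) (w * b)) (cong₂ ℚ._+_
           (trans (fromℤ-+ (u * x) (v * y)) (cong₂ ℚ._+_ (scale α u x αd≡u) (scale β v y βd≡v))) (scale γ w b γd≡w)) ⟩
    α ℚ.* fromℕ d ℚ.* fromℤ x ℚ.+ β ℚ.* fromℕ d ℚ.* fromℤ y ℚ.+ γ ℚ.* fromℕ d ℚ.* fromℤ b
      ≡⟨ solve 7 (λ α β γ d x y b → α :* d :* x :+ β :* d :* y :+ γ :* d :* b := d :* (α :* x :+ β :* y :+ γ :* b))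
           refl α β γ (fromℕ d) (fromℤ x) (fromℤ y) (fromℤ b) ⟩
    fromℕ d ℚ.* (α ℚ.* fromℤ x ℚ.+ β ℚ.* fromℤ y ℚ.+ γ ℚ.* fromℤ b) ∎)
    where
    scale : ∀ δ z x → δ ℚ.* fromℕ d ≡ fromℤ z → fromℤ (z * x) ≡ δ ℚ.* fromℕ d ℚ.* fromℤ x
    scale δ z x δd≡z = trans (fromℤ-* z x) (cong (ℚ._* fromℤ x) (sym δd≡z))

  scale-denominator : ∀ k n α z → α ℚ.* fromℕ k ≡ fromℤ z → α ℚ.* fromℕ (k ℕ.* n) ≡ fromℤ (z * + n)
  scale-denominator k n α z αk≡z = begin
    α ℚ.* fromℕ (k ℕ.* n)             ≡⟨ cong (λ m → α ℚ.* fromℤ m) (ℤ.pos-* k n) ⟩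
    α ℚ.* fromℤ (+ k * + n)           ≡⟨ cong (α ℚ.*_) (fromℤ-* (+ k) (+ n)) ⟩
    α ℚ.* (fromℕ k ℚ.* fromℕ n)       ≡⟨ ℚ.*-assoc α (fromℕ k) (fromℕ n) ⟨
    α ℚ.* fromℕ k ℚ.* fromℕ n         ≡⟨ cong (ℚ._* fromℕ n) αk≡z ⟩
    fromℤ z ℚ.* fromℕ n               ≡⟨ fromℤ-* z (+ n) ⟨
    fromℤ (z * + n)                   ∎

open import Data.Nat.Base using (_*_; _^_)
open import Data.Integer.Base using (+_)
open import Data.Rational.Base using (_+_; _-_; -_) renaming (_*_ to _*ℚ_)

theorem2p1 : ∀ (n : ℕ) → .{{_ : NonZero n}} →
    (fromℤ (τ n) ≡ fromℕ (n ^ 2 * σ 7 n)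
    - fromℕ 540 *ℚ fromℕ (∑[1≤ m < n ] (m * (n ∸ m) * σ 3 m * σ 3 (n ∸ m))))
    × (fromℤ (τ n) ≡ - (+ 5 / 4) *ℚ fromℕ (n ^ 2 * σ 7 n) + (+ 9 / 4) *ℚ fromℕ (n ^ 2 * σ 3 n)
    + fromℕ 540 *ℚ fromℕ (∑[1≤ m < n ] (m ^ 2 * σ 3 m * σ 3 (n ∸ m))))
    × (fromℤ (τ n) ≡ fromℕ (n ^ 2 * σ 7 n)
    - (+ 1080 / n) *ℚ fromℕ (∑[1≤ m < n ] (m ^ 2 * (n ∸ m) * σ 3 m * σ 3 (n ∸ m))))
    × (fromℤ (τ n) ≡ - (+ 1 / 2) *ℚ fromℕ (n ^ 2 * σ 7 n) + (+ 3 / 2) *ℚ fromℕ (n ^ 2 * σ 3 n)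
    + (+ 360 / n) *ℚ fromℕ (∑[1≤ m < n ] (m ^ 3 * σ 3 m * σ 3 (n ∸ m))))
theorem2p1 n =
  divide₂ 1 (fromℕ 540) (τ n) (+ X) (+ 540) (+ A) refl (trans (ℤ.*-identityˡ (τ n)) (trans identity-i
    (cong (ℤ._- + 540 ℤ.* + A) (sym (ℤ.*-identityˡ (+ X)))))) ,
  divide₃ 4 (- (+ 5 / 4)) (+ 9 / 4) (fromℕ 540) (τ n) (ℤ.- + 5) (+ X) (+ 9) (+ Y) (+ 2160) (+ B)
    refl refl refl identity-ii ,
  divide₂ n (+ 1080 / n) (τ n) (+ X) (+ 1080) (+ C) (/-*-fromℕ (+ 1080) n) identity-iii ,
  -- Over the denominator 6 n of `identity-iv`, the coefficients -1/2, 3/2 and 360/n have numerators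
  -- -3 n, 9 n and 2160.
  divide₃ (6 * n) {{ℕ.m*n≢0 6 n}} (- (+ 1 / 2)) (+ 3 / 2) (+ 360 / n)
    (τ n) (ℤ.- + 3 ℤ.* + n) (+ X) (+ 9 ℤ.* + n) (+ Y) (+ 2160) (+ G)
    (scale-denominator 6 n (- (+ 1 / 2)) (ℤ.- + 3) refl) (scale-denominator 6 n (+ 3 / 2) (+ 9) refl) γ-denominator
    (trans (cong (ℤ._* τ n) (ℤ.pos-* 6 n)) identity-iv)
  where
  open ≡-Reasoning
  open Identities
  open Denominators
  open Convolutions n
  γ-denominator : + 360 / n *ℚ fromℕ (6 * n) ≡ fromℤ (+ 2160)
  γ-denominator = begin
    + 360 / n *ℚ fromℕ (6 * n)    ≡⟨ cong (λ k → + 360 / n *ℚ fromℕ k) (ℕ.*-comm 6 n) ⟩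
    + 360 / n *ℚ fromℕ (n * 6)    ≡⟨ scale-denominator n 6 (+ 360 / n) (+ 360) (/-*-fromℕ (+ 360) n) ⟩
    fromℤ (+ 2160)                ∎
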